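{- Let $K$ be a number field (a finite extension of $\mathbb{Q}$) and let $C\subseteq\omega$ be a cohesive set. Then the group $\mathrm{Aut}(\prod_C K/\prod_C\mathbb{Q})$ is isomorphic to $\mathrm{Aut}(K/\mathbb{Q})$.
   Context: For $A,B\subseteq\omega$, $A\subseteq^* B$ means $A\setminus B$ is finite. A set $C\subseteq\omega$ is cohesive if it is infinite and for every c.e. set $W$ either $C\subseteq^*W$ or $C\subseteq^*\overline{W}$. A computable structure has computable domain $\subseteq\omega$ and computable atomic diagram. For a computable structure $\mathcal A$ and cohesive $C$, the cohesive power $\prod_C\mathcal A$ has as domain the classes $[\varphi]$ of partial computable functions $\varphi$ from $\omega$ to $\mathcal{A}$ with $C\subseteq^*\mathrm{dom}(\varphi)$, where $[\varphi]=[\psi]$ iff $C\subseteq^*\{i:\varphi(i){\downarrow}=\psi(i){\downarrow}\}$; functions and constants are interpreted pointwise, and a relation $R$ holds of $[\varphi_0],\dots,[\varphi_{m-1}]$ iff $C\subseteq^*\{i: R^{\mathcal A}(\varphi_0(i),\dots,\varphi_{m-1}(i))\}$. $K$ is given a computable presentation as a field; $\prod_C\mathbb{Q}$ is regarded as the subfield of $\prod_CK$ of classes of partial computable functions with values in $\mathbb{Q}\subseteq K$. $\mathrm{Aut}(L/E)$ is the group of field automorphisms of $L$ fixing $E$ pointwise. -}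

module Defs where

open import Algebra.Bundles using (CommutativeRing; Group)
open import Algebra.Morphism.Structures using (IsRingHomomorphism; IsRingIsomorphism; IsGroupIsomorphism)
open import Algebra.Structures using (IsCommutativeRing)
import Algebra.Morphism.Construct.Composition as Composition
import Algebra.Morphism.Construct.Identity as Identity
import Algebra.Properties.CommutativeMonoid.Sum as Sum
open import Data.Fin.Base using (Fin)
open import Data.List.Base using (List; []; _++_)
import Data.List.Membership.Propositional as List
open import Data.List.Membership.Propositional.Properties using (∈-++⁺ˡ; ∈-++⁺ʳ)
open import Data.Nat.Base using (ℕ; zero; suc; _≤_; _<_)
open import Data.Nat.Properties using (<-cmp)
open import Data.Product.Base using (Σ; ∃; _×_; _,_; proj₁; proj₂)
open import Data.Rational.Base using (ℚ; 0ℚ; +-*-rawRing)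
open import Data.Sum.Base using (_⊎_; inj₁; inj₂)
open import Data.Vec.Base using (Vec; []; _∷_; lookup)
open import Data.Vec.Relation.Binary.Pointwise.Inductive using (Pointwise; []; _∷_)
open import Function.Base using (_∘_; id)
open import Level using (0ℓ; _⊔_) renaming (suc to lsuc)
open import Relation.Binary.Definitions using (tri<; tri≈; tri>)
open import Relation.Binary.PropositionalEquality.Core using (_≡_; refl; cong₂; subst)
open import Relation.Nullary.Negation.Core using (¬_)
open import Relation.Unary using (Pred; _∈_; _∩_; ∁)

-- Codes for the partial μ-recursive functions ℕⁿ ⇀ ℕ; f [ xs ]⇓ y says that
-- f converges on xs with value y.
data Code : ℕ → Set where
  Z    : ∀ {n} → Code n
  S    : Code 1
  proj : ∀ {n} → Fin n → Code n
  comp : ∀ {m n} → Code m → Vec (Code n) m → Code n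
  prec : ∀ {n} → Code n → Code (suc (suc n)) → Code (suc n)
  μ    : ∀ {n} → Code (suc n) → Code n

infix 4 _[_]⇓_

data _[_]⇓_ : ∀ {n} → Code n → Vec ℕ n → ℕ → Set where
  ⇓Z    : ∀ {n} {xs : Vec ℕ n} → Z [ xs ]⇓ 0
  ⇓S    : ∀ {x} → S [ x ∷ [] ]⇓ suc x
  ⇓proj : ∀ {n} {xs : Vec ℕ n} (i : Fin n) → proj i [ xs ]⇓ lookup xs i
  ⇓comp : ∀ {m n} {f : Code m} {gs : Vec (Code n) m} {xs : Vec ℕ n} {ys : Vec ℕ m} {z} →
          Pointwise (λ g y → g [ xs ]⇓ y) gs ys → f [ ys ]⇓ z → comp f gs [ xs ]⇓ z
  ⇓prec-zero : ∀ {n} {f : Code n} {g : Code (suc (suc n))} {xs : Vec ℕ n} {y} →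
               f [ xs ]⇓ y → prec f g [ 0 ∷ xs ]⇓ y
  ⇓prec-suc  : ∀ {n} {f : Code n} {g : Code (suc (suc n))} {xs : Vec ℕ n} {k r y} →
               prec f g [ k ∷ xs ]⇓ r → g [ k ∷ r ∷ xs ]⇓ y → prec f g [ suc k ∷ xs ]⇓ y
  ⇓μ    : ∀ {n} {f : Code (suc n)} {xs : Vec ℕ n} {k} →
          f [ k ∷ xs ]⇓ 0 → (∀ j → j < k → ∃ λ y → f [ j ∷ xs ]⇓ suc y) → μ f [ xs ]⇓ k

private
  0≢suc : ∀ {n} {A : Set} → 0 ≡ suc n → A
  0≢suc ()

mutual
  ⇓-deterministic : ∀ {n} {f : Code n} {xs y z} → f [ xs ]⇓ y → f [ xs ]⇓ z → y ≡ z
  ⇓-deterministic ⇓Z ⇓Z = refl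
  ⇓-deterministic ⇓S ⇓S = refl
  ⇓-deterministic (⇓proj i) (⇓proj .i) = refl
  ⇓-deterministic (⇓comp ps p) (⇓comp qs q) with ⇓⋆-deterministic ps qs
  ... | refl = ⇓-deterministic p q
  ⇓-deterministic (⇓prec-zero p) (⇓prec-zero q) = ⇓-deterministic p q
  ⇓-deterministic (⇓prec-suc p p′) (⇓prec-suc q q′) with ⇓-deterministic p q
  ... | refl = ⇓-deterministic p′ q′
  ⇓-deterministic (⇓μ {k = k} p ps) (⇓μ {k = l} q qs) with <-cmp k l
  ... | tri< k<l _ _ = 0≢suc (⇓-deterministic p (proj₂ (qs k k<l)))
  ... | tri≈ _ k≡l _ = k≡l
  ... | tri> _ _ l<k = 0≢suc (⇓-deterministic q (proj₂ (ps l l<k)))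

  ⇓⋆-deterministic : ∀ {m n} {gs : Vec (Code n) m} {xs : Vec ℕ n} {ys zs : Vec ℕ m} →
                     Pointwise (λ g y → g [ xs ]⇓ y) gs ys →
                     Pointwise (λ g y → g [ xs ]⇓ y) gs zs → ys ≡ zs
  ⇓⋆-deterministic [] [] = refl
  ⇓⋆-deterministic (p ∷ ps) (q ∷ qs) = cong₂ _∷_ (⇓-deterministic p q) (⇓⋆-deterministic ps qs)

numeral : ∀ {n} → ℕ → Code n
numeral zero    = Z
numeral (suc k) = comp S (numeral k ∷ [])

⇓numeral : ∀ {n} {xs : Vec ℕ n} k → numeral k [ xs ]⇓ k
⇓numeral zero    = ⇓Z
⇓numeral (suc k) = ⇓comp (⇓numeral k ∷ []) ⇓S

dom : Code 1 → Pred ℕ 0ℓ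
dom f i = ∃ λ y → f [ i ∷ [] ]⇓ y

-- A ∖ B is finite.  Finiteness is expressed positively, by a list F that
-- covers A ∖ B, so that n ∈ B is recovered (and not just ¬ n ∉ B) from
-- n ∈ A when n is outside F.
infix 4 _⊆*_

_⊆*_ : ∀ {a b} → Pred ℕ a → Pred ℕ b → Set (a ⊔ b)
A ⊆* B = ∃ λ (F : List ℕ) → ∀ {n} → n ∈ A → n ∈ B ⊎ n List.∈ F

⊆*-map : ∀ {a b c} {A : Pred ℕ a} {B : Pred ℕ b} {C : Pred ℕ c} →
         (∀ {n} → n ∈ B → n ∈ C) → A ⊆* B → A ⊆* C
⊆*-map {A = A} {B} {C} f (F , p) = F , q
  where
  q : ∀ {n} → n ∈ A → n ∈ C ⊎ n List.∈ F
  q n∈A with p n∈A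
  ... | inj₁ n∈B = inj₁ (f n∈B)
  ... | inj₂ n∈F = inj₂ n∈F

⊆*-∩ : ∀ {a b c} {A : Pred ℕ a} {B : Pred ℕ b} {C : Pred ℕ c} →
       A ⊆* B → A ⊆* C → A ⊆* (B ∩ C)
⊆*-∩ {A = A} {B} {C} (F , p) (G , q) = F ++ G , r
  where
  r : ∀ {n} → n ∈ A → n ∈ (B ∩ C) ⊎ n List.∈ (F ++ G)
  r n∈A with p n∈A | q n∈A
  ... | inj₂ n∈F | _        = inj₂ (∈-++⁺ˡ n∈F)
  ... | inj₁ _   | inj₂ n∈G = inj₂ (∈-++⁺ʳ F n∈G)
  ... | inj₁ n∈B | inj₁ n∈C = inj₁ (n∈B , n∈C)

⊆*-always : ∀ {a b} {A : Pred ℕ a} {B : Pred ℕ b} → (∀ n → n ∈ B) → A ⊆* B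
⊆*-always b = [] , λ {n} _ → inj₁ (b n)

Infinite : ∀ {a} → Pred ℕ a → Set a
Infinite A = ∀ m → ∃ λ n → m ≤ n × n ∈ A

-- The c.e. sets are the domains of the partial computable functions.
record Cohesive {a} (C : Pred ℕ a) : Set a where
  field
    infinite   : Infinite C
    indivisible : ∀ (e : Code 1) → C ⊆* dom e ⊎ C ⊆* ∁ (dom e)

record Field c ℓ : Set (lsuc (c ⊔ ℓ)) where
  field
    commutativeRing : CommutativeRing c ℓ
  open CommutativeRing commutativeRing public
  field
    0≉1     : ¬ 0# ≈ 1#
    inverse : ∀ x → ¬ x ≈ 0# → ∃ λ y → x * y ≈ 1#

-- A field K with an embedding ι of ℚ that makes K a ℚ-vector space with a
-- finite basis.
record NumberField c ℓ : Set (lsuc (c ⊔ ℓ)) where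
  field
    K : Field c ℓ
  open Field K public
  open Sum +-commutativeMonoid using (sum)
  field
    ι                : ℚ → Carrier
    ι-isHomomorphism : IsRingHomomorphism +-*-rawRing rawRing ι
    degree           : ℕ
    basis            : Fin degree → Carrier
    spanning         : ∀ x → ∃ λ (q : Fin degree → ℚ) → x ≈ sum (λ i → ι (q i) * basis i)
    independent      : ∀ (q : Fin degree → ℚ) → sum (λ i → ι (q i) * basis i) ≈ 0# →
                       ∀ i → q i ≡ 0ℚ

  rationals : Pred Carrier ℓ
  rationals x = ∃ λ q → ι q ≈ x

-- Aut L E is the group of ring automorphisms of L fixing the subset E
-- pointwise; for a field L these are its field automorphisms.
module _ {c ℓ e} (L : CommutativeRing c ℓ) (E : Pred (CommutativeRing.Carrier L) e) where
  private
    module L = CommutativeRing L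

  record Automorphism : Set (c ⊔ ℓ ⊔ e) where
    field
      ⟦_⟧                : L.Carrier → L.Carrier
      isRingIsomorphism  : IsRingIsomorphism L.rawRing L.rawRing ⟦_⟧
      fixes              : ∀ x → x ∈ E → ⟦ x ⟧ L.≈ x
    open IsRingIsomorphism isRingIsomorphism public

  open Automorphism using (⟦_⟧)

  private
    _∘ᴬ_ : Automorphism → Automorphism → Automorphism
    σ ∘ᴬ τ = record
      { ⟦_⟧               = ⟦ σ ⟧ ∘ ⟦ τ ⟧
      ; isRingIsomorphism = Composition.isRingIsomorphism L.trans τ.isRingIsomorphism σ.isRingIsomorphism
      ; fixes             = λ x x∈E → L.trans (σ.⟦⟧-cong (τ.fixes x x∈E)) (σ.fixes x x∈E)
      }
      where
      module σ = Automorphism σ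
      module τ = Automorphism τ

    idᴬ : Automorphism
    idᴬ = record
      { ⟦_⟧               = id
      ; isRingIsomorphism = Identity.isRingIsomorphism L.rawRing L.refl
      ; fixes             = λ _ _ → L.refl
      }

    _⁻¹ᴬ : Automorphism → Automorphism
    σ ⁻¹ᴬ = record
      { ⟦_⟧               = σ⁻¹
      ; isRingIsomorphism = record
        { isRingMonomorphism = record
          { isRingHomomorphism = record
            { isSemiringHomomorphism = record
              { isNearSemiringHomomorphism = record
                { +-isMonoidHomomorphism = record
                  { isMagmaHomomorphism = record
                    { isRelHomomorphism = record { cong = σ⁻¹-cong }
                    ; homo = λ x y → σ.injective (L.trans (invˡ (x L.+ y)) (L.sym
                        (L.trans (σ.+-homo _ _) (L.+-cong (invˡ x) (invˡ y)))))
                    }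
                  ; ε-homo = σ.injective (L.trans (invˡ L.0#) (L.sym σ.0#-homo))
                  }
                ; *-homo = λ x y → σ.injective (L.trans (invˡ (x L.* y)) (L.sym
                    (L.trans (σ.*-homo _ _) (L.*-cong (invˡ x) (invˡ y)))))
                }
              ; 1#-homo = σ.injective (L.trans (invˡ L.1#) (L.sym σ.1#-homo))
              }
            ; -‿homo = λ x → σ.injective (L.trans (invˡ (L.- x)) (L.sym
                (L.trans (σ.-‿homo _) (L.-‿cong (invˡ x)))))
            }
          ; injective = λ {x} {y} p → L.trans (L.sym (invˡ x)) (L.trans (σ.⟦⟧-cong p) (invˡ y))
          }
        ; surjective = λ y → ⟦ σ ⟧ y ,
            λ z≈ → σ.injective (L.trans (invˡ _) z≈)
        }
      ; fixes = λ x x∈E → σ.injective (L.trans (invˡ x) (L.sym (σ.fixes x x∈E)))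
      }
      where
      module σ = Automorphism σ
      σ⁻¹ : L.Carrier → L.Carrier
      σ⁻¹ y = proj₁ (σ.surjective y)
      invˡ : ∀ y → ⟦ σ ⟧ (σ⁻¹ y) L.≈ y
      invˡ y = proj₂ (σ.surjective y) L.refl
      σ⁻¹-cong : ∀ {x y} → x L.≈ y → σ⁻¹ x L.≈ σ⁻¹ y
      σ⁻¹-cong {x} {y} x≈y = σ.injective (L.trans (invˡ x) (L.trans x≈y (L.sym (invˡ y))))

  Aut : Group (c ⊔ ℓ ⊔ e) (c ⊔ ℓ)
  Aut = record
    { Carrier = Automorphism
    ; _≈_     = λ σ τ → ∀ x → ⟦ σ ⟧ x L.≈ ⟦ τ ⟧ x
    ; _∙_     = _∘ᴬ_
    ; ε       = idᴬ
    ; _⁻¹     = _⁻¹ᴬ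
    ; isGroup = record
      { isMonoid = record
        { isSemigroup = record
          { isMagma = record
            { isEquivalence = record
              { refl  = λ _ → L.refl
              ; sym   = λ p x → L.sym (p x)
              ; trans = λ p q x → L.trans (p x) (q x)
              }
            ; ∙-cong = λ {σ} p q x →
                L.trans (Automorphism.⟦⟧-cong σ (q x)) (p _)
            }
          ; assoc = λ _ _ _ _ → L.refl
          }
        ; identity = (λ _ _ → L.refl) , (λ _ _ → L.refl)
        }
      ; inverse = (λ σ x → Automorphism.injective σ (proj₂ (Automorphism.surjective σ _) L.refl))
                , (λ σ x → proj₂ (Automorphism.surjective σ x) L.refl)
      ; ⁻¹-cong = λ {σ} {τ} p x → Automorphism.injective σ
          (L.trans (proj₂ (Automorphism.surjective σ x) L.refl)
          (L.trans (L.sym (proj₂ (Automorphism.surjective τ x) L.refl)) (L.sym (p _))))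
      }
    }

infix 4 _≅_

_≅_ : ∀ {a b ℓ₁ ℓ₂} → Group a ℓ₁ → Group b ℓ₂ → Set (a ⊔ b ⊔ ℓ₁ ⊔ ℓ₂)
G ≅ H = ∃ λ (f : Group.Carrier G → Group.Carrier H) →
        IsGroupIsomorphism (Group.rawGroup G) (Group.rawGroup H) f

-- The domain is the set with characteristic function χ; elements are
-- compared as natural numbers, ignoring the evidence that they lie in the
-- domain.  The language has no relation symbols other than equality, so
-- computability of the atomic diagram amounts to computability of the
-- domain and the operations.  Inversion in a field is not part of the
-- language (it is then computable by search).
record ComputableRing : Set where
  field
    χ       : Code 1
    χ-total : ∀ n → χ [ n ∷ [] ]⇓ 0 ⊎ χ [ n ∷ [] ]⇓ 1

  Domain : Pred ℕ 0ℓ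
  Domain n = χ [ n ∷ [] ]⇓ 1

  Carrier : Set
  Carrier = Σ ℕ Domain

  infix 4 _≈_
  _≈_ : Carrier → Carrier → Set
  x ≈ y = proj₁ x ≡ proj₁ y

  infixl 7 _*_
  infixl 6 _+_
  infix  8 -_
  field
    _+_ _*_ : Carrier → Carrier → Carrier
    -_      : Carrier → Carrier
    0# 1#   : Carrier
    isCommutativeRing : IsCommutativeRing _≈_ _+_ _*_ -_ 0# 1#
    +-code : Code 2
    *-code : Code 2
    neg-code : Code 1
    +-computable : ∀ x y → +-code [ proj₁ x ∷ proj₁ y ∷ [] ]⇓ proj₁ (x + y)
    *-computable : ∀ x y → *-code [ proj₁ x ∷ proj₁ y ∷ [] ]⇓ proj₁ (x * y)
    neg-computable : ∀ x → neg-code [ proj₁ x ∷ [] ]⇓ proj₁ (- x)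

  commutativeRing : CommutativeRing 0ℓ 0ℓ
  commutativeRing = record { isCommutativeRing = isCommutativeRing }

  open CommutativeRing commutativeRing public using (rawRing; isEquivalence)

record ComputablePresentation {c ℓ} (K : CommutativeRing c ℓ) : Set (c ⊔ ℓ) where
  field
    structure     : ComputableRing
    to            : CommutativeRing.Carrier K → ComputableRing.Carrier structure
    isIsomorphism : IsRingIsomorphism (CommutativeRing.rawRing K) (ComputableRing.rawRing structure) to

module Power {p} (C : Pred ℕ p) (𝒜 : ComputableRing) where
  private
    module A = ComputableRing 𝒜
    module R = IsCommutativeRing A.isCommutativeRing

  -- Elements are the functions φ themselves; passing to the classes [φ] is
  -- replaced by the equivalence _≈_ below.
  record Element : Set p where
    field
      code    : Code 1
      values  : ∀ {i y} → code [ i ∷ [] ]⇓ y → A.Domain y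
      defined : C ⊆* dom code

  open Element public

  infix 4 _≈_ _at_↦_

  record _≈_ (φ ψ : Element) : Set p where
    constructor agree
    field
      almostEverywhere : C ⊆* λ i → ∃ λ y → code φ [ i ∷ [] ]⇓ y × code ψ [ i ∷ [] ]⇓ y

  open _≈_ public

  record _at_↦_ (φ : Element) (i : ℕ) (x : A.Carrier) : Set where
    constructor value
    field
      converges : code φ [ i ∷ [] ]⇓ proj₁ x

  Converges : Element → Pred ℕ 0ℓ
  Converges φ i = ∃ λ x → φ at i ↦ x

  convergesAlmostEverywhere : ∀ φ → C ⊆* Converges φ
  convergesAlmostEverywhere φ =
    ⊆*-map (λ { (y , φ⇓y) → (y , values φ φ⇓y) , value φ⇓y }) (defined φ)

  pointwise₁ : (c : Code 1) (op : A.Carrier → A.Carrier) →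
               (∀ x → c [ proj₁ x ∷ [] ]⇓ proj₁ (op x)) → Element → Element
  pointwise₁ c op c-computes φ = record
    { code    = comp c (code φ ∷ [])
    ; values  = λ { (⇓comp (p ∷ []) q) → subst A.Domain
                      (⇓-deterministic (c-computes (_ , values φ p)) q)
                      (proj₂ (op (_ , values φ p))) }
    ; defined = ⊆*-map (λ { (x , value p) → _ , ⇓comp (p ∷ []) (c-computes x) })
                       (convergesAlmostEverywhere φ)
    }

  pointwise₂ : (c : Code 2) (op : A.Carrier → A.Carrier → A.Carrier) →
               (∀ x y → c [ proj₁ x ∷ proj₁ y ∷ [] ]⇓ proj₁ (op x y)) →
               Element → Element → Element
  pointwise₂ c op c-computes φ ψ = record
    { code    = comp c (code φ ∷ code ψ ∷ [])
    ; values  = λ { (⇓comp (p ∷ q ∷ []) r) → subst A.Domain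
                      (⇓-deterministic (c-computes (_ , values φ p) (_ , values ψ q)) r)
                      (proj₂ (op (_ , values φ p) (_ , values ψ q))) }
    ; defined = ⊆*-map
        (λ { ((x , value p) , (y , value q)) → _ , ⇓comp (p ∷ q ∷ []) (c-computes x y) })
        (⊆*-∩ (convergesAlmostEverywhere φ) (convergesAlmostEverywhere ψ))
    }

  constant : A.Carrier → Element
  constant x = record
    { code    = numeral (proj₁ x)
    ; values  = λ p → subst A.Domain (⇓-deterministic (⇓numeral (proj₁ x)) p) (proj₂ x)
    ; defined = ⊆*-always λ _ → _ , ⇓numeral (proj₁ x)
    }

  infixl 6 _+_
  infixl 7 _*_
  infix  8 -_

  _+_ _*_ : Element → Element → Element
  _+_ = pointwise₂ A.+-code A._+_ A.+-computable
  _*_ = pointwise₂ A.*-code A._*_ A.*-computable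

  -_ : Element → Element
  -_ = pointwise₁ A.neg-code A.-_ A.neg-computable

  0# 1# : Element
  0# = constant A.0#
  1# = constant A.1#

  infixl 6 _⊕_
  infixl 7 _⊗_
  infix  8 ⊖_

  _⊕_ : ∀ {φ ψ i x y} → φ at i ↦ x → ψ at i ↦ y → (φ + ψ) at i ↦ (x A.+ y)
  value p ⊕ value q = value (⇓comp (p ∷ q ∷ []) (A.+-computable _ _))

  _⊗_ : ∀ {φ ψ i x y} → φ at i ↦ x → ψ at i ↦ y → (φ * ψ) at i ↦ (x A.* y)
  value p ⊗ value q = value (⇓comp (p ∷ q ∷ []) (A.*-computable _ _))

  ⊖_ : ∀ {φ i x} → φ at i ↦ x → (- φ) at i ↦ (A.- x)
  ⊖ value p = value (⇓comp (p ∷ []) (A.neg-computable _))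

  constant-value : ∀ x {i} → constant x at i ↦ x
  constant-value x = value (⇓numeral (proj₁ x))

  ↦-unique : ∀ {φ i x y} → φ at i ↦ x → φ at i ↦ y → x A.≈ y
  ↦-unique (value p) (value q) = ⇓-deterministic p q

  ↦-resp : ∀ {φ i x y} → x A.≈ y → φ at i ↦ x → φ at i ↦ y
  ↦-resp {φ} {i} x≈y (value p) = value (subst (λ v → code φ [ i ∷ [] ]⇓ v) x≈y p)

  Agree : Element → Element → Pred ℕ 0ℓ
  Agree φ ψ i = ∃ λ x → φ at i ↦ x × ψ at i ↦ x

  fromAgree : ∀ {φ ψ} → C ⊆* Agree φ ψ → φ ≈ ψ
  fromAgree p = agree (⊆*-map (λ { ((y , _) , value a , value b) → y , a , b }) p)

  toAgree : ∀ {φ ψ} → φ ≈ ψ → C ⊆* Agree φ ψ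
  toAgree {φ} (agree p) =
    ⊆*-map (λ { (y , a , b) → (y , values φ a) , value a , value b }) p

  lift₁ : ∀ α {φ ψ} {l r : A.Carrier → A.Carrier} → (∀ x → l x A.≈ r x) →
          (∀ {i x} → α at i ↦ x → φ at i ↦ l x × ψ at i ↦ r x) → φ ≈ ψ
  lift₁ α {φ} {ψ} {l} {r} l≈r f = fromAgree (⊆*-map g (convergesAlmostEverywhere α))
    where
    g : ∀ {i} → i ∈ Converges α → i ∈ Agree φ ψ
    g (x , p) = r x , ↦-resp (l≈r x) (proj₁ (f p)) , proj₂ (f p)

  lift₂ : ∀ α β {φ ψ} {l r : A.Carrier → A.Carrier → A.Carrier} → (∀ x y → l x y A.≈ r x y) →
          (∀ {i x y} → α at i ↦ x → β at i ↦ y → φ at i ↦ l x y × ψ at i ↦ r x y) → φ ≈ ψ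
  lift₂ α β {φ} {ψ} {l} {r} l≈r f =
    fromAgree (⊆*-map g (⊆*-∩ (convergesAlmostEverywhere α) (convergesAlmostEverywhere β)))
    where
    g : ∀ {i} → i ∈ (Converges α ∩ Converges β) → i ∈ Agree φ ψ
    g ((x , p) , (y , q)) = r x y , ↦-resp (l≈r x y) (proj₁ (f p q)) , proj₂ (f p q)

  lift₃ : ∀ α β γ {φ ψ} {l r : A.Carrier → A.Carrier → A.Carrier → A.Carrier} →
          (∀ x y z → l x y z A.≈ r x y z) →
          (∀ {i x y z} → α at i ↦ x → β at i ↦ y → γ at i ↦ z →
             φ at i ↦ l x y z × ψ at i ↦ r x y z) → φ ≈ ψ
  lift₃ α β γ {φ} {ψ} {l} {r} l≈r f =
    fromAgree (⊆*-map g (⊆*-∩ (⊆*-∩ (convergesAlmostEverywhere α) (convergesAlmostEverywhere β))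
                              (convergesAlmostEverywhere γ)))
    where
    g : ∀ {i} → i ∈ ((Converges α ∩ Converges β) ∩ Converges γ) → i ∈ Agree φ ψ
    g (((x , p) , (y , q)) , (z , s)) =
      r x y z , ↦-resp (l≈r x y z) (proj₁ (f p q s)) , proj₂ (f p q s)

  ≈-refl : ∀ {φ} → φ ≈ φ
  ≈-refl {φ} = agree (⊆*-map (λ { (y , p) → y , p , p }) (defined φ))

  ≈-sym : ∀ {φ ψ} → φ ≈ ψ → ψ ≈ φ
  ≈-sym (agree p) = agree (⊆*-map (λ { (y , a , b) → y , b , a }) p)

  ≈-trans : ∀ {φ ψ χ} → φ ≈ ψ → ψ ≈ χ → φ ≈ χ
  ≈-trans {φ} {ψ} {χ} p q = fromAgree (⊆*-map g (⊆*-∩ (toAgree p) (toAgree q)))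
    where
    g : ∀ {i} → i ∈ (Agree φ ψ ∩ Agree ψ χ) → i ∈ Agree φ χ
    g ((x , a , b) , (y , b′ , c)) = x , a , ↦-resp (↦-unique b′ b) c

  +-cong : ∀ {φ φ′ ψ ψ′} → φ ≈ φ′ → ψ ≈ ψ′ → (φ + ψ) ≈ (φ′ + ψ′)
  +-cong {φ} {φ′} {ψ} {ψ′} p q = fromAgree (⊆*-map g (⊆*-∩ (toAgree p) (toAgree q)))
    where
    g : ∀ {i} → i ∈ (Agree φ φ′ ∩ Agree ψ ψ′) → i ∈ Agree (φ + ψ) (φ′ + ψ′)
    g ((_ , a , a′) , (_ , b , b′)) = _ , a ⊕ b , a′ ⊕ b′

  *-cong : ∀ {φ φ′ ψ ψ′} → φ ≈ φ′ → ψ ≈ ψ′ → (φ * ψ) ≈ (φ′ * ψ′)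
  *-cong {φ} {φ′} {ψ} {ψ′} p q = fromAgree (⊆*-map g (⊆*-∩ (toAgree p) (toAgree q)))
    where
    g : ∀ {i} → i ∈ (Agree φ φ′ ∩ Agree ψ ψ′) → i ∈ Agree (φ * ψ) (φ′ * ψ′)
    g ((_ , a , a′) , (_ , b , b′)) = _ , a ⊗ b , a′ ⊗ b′

  -‿cong : ∀ {φ φ′} → φ ≈ φ′ → (- φ) ≈ (- φ′)
  -‿cong {φ} {φ′} p = fromAgree (⊆*-map g (toAgree p))
    where
    g : ∀ {i} → i ∈ Agree φ φ′ → i ∈ Agree (- φ) (- φ′)
    g (_ , a , a′) = _ , ⊖ a , ⊖ a′

  commutativeRing : CommutativeRing p p
  commutativeRing = record
    { Carrier = Element
    ; _≈_     = _≈_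
    ; _+_     = _+_
    ; _*_     = _*_
    ; -_      = -_
    ; 0#      = 0#
    ; 1#      = 1#
    ; isCommutativeRing = record
      { isRing = record
        { +-isAbelianGroup = record
          { isGroup = record
            { isMonoid = record
              { isSemigroup = record
                { isMagma = record
                  { isEquivalence = record { refl = ≈-refl ; sym = ≈-sym ; trans = ≈-trans }
                  ; ∙-cong        = +-cong
                  }
                ; assoc = λ α β γ → lift₃ α β γ R.+-assoc λ p q r → (p ⊕ q) ⊕ r , p ⊕ (q ⊕ r)
                }
              ; identity = (λ α → lift₁ α R.+-identityˡ λ p → constant-value _ ⊕ p , p)
                         , (λ α → lift₁ α R.+-identityʳ λ p → p ⊕ constant-value _ , p)
              }
            ; inverse = (λ α → lift₁ α R.-‿inverseˡ λ p → ⊖ p ⊕ p , constant-value _)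
                      , (λ α → lift₁ α R.-‿inverseʳ λ p → p ⊕ ⊖ p , constant-value _)
            ; ⁻¹-cong = -‿cong
            }
          ; comm = λ α β → lift₂ α β R.+-comm λ p q → p ⊕ q , q ⊕ p
          }
        ; *-cong     = *-cong
        ; *-assoc    = λ α β γ → lift₃ α β γ R.*-assoc λ p q r → (p ⊗ q) ⊗ r , p ⊗ (q ⊗ r)
        ; *-identity = (λ α → lift₁ α R.*-identityˡ λ p → constant-value _ ⊗ p , p)
                     , (λ α → lift₁ α R.*-identityʳ λ p → p ⊗ constant-value _ , p)
        ; distrib    = (λ α β γ → lift₃ α β γ R.distribˡ λ p q r → p ⊗ (q ⊕ r) , p ⊗ q ⊕ p ⊗ r)
                     , (λ α β γ → lift₃ α β γ R.distribʳ λ p q r → (q ⊕ r) ⊗ p , q ⊗ p ⊕ r ⊗ p)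
        }
      ; *-comm = λ α β → lift₂ α β R.*-comm λ p q → p ⊗ q , q ⊗ p
      }
    }

  -- The classes that have a representative with all its values in B ⊆ 𝒜.
  ValuedIn : Pred ℕ 0ℓ → Pred Element p
  ValuedIn B φ = ∃ λ ψ → (∀ {i y} → code ψ [ i ∷ [] ]⇓ y → y ∈ B) × ψ ≈ φ

∏ : ∀ {p} → Pred ℕ p → ComputableRing → CommutativeRing p p
∏ = Power.commutativeRing

module _ {c ℓ} (𝐊 : NumberField c ℓ)
         (𝒜 : ComputablePresentation (NumberField.commutativeRing 𝐊)) where
  open NumberField 𝐊
  open ComputablePresentation 𝒜

  -- The copy of ℚ inside the domain of the presentation of K.
  ℚ⊆ : Pred ℕ 0ℓ
  ℚ⊆ n = ∃ λ q → proj₁ (to (ι q)) ≡ n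

  ∏ℚ : ∀ {p} (C : Pred ℕ p) → Pred (CommutativeRing.Carrier (∏ C structure)) p
  ∏ℚ C = Power.ValuedIn C structure ℚ⊆

{-# OPTIONS --safe #-}

-- An automorphism σ of ∏K over ∏ℚ maps the constant class of x ∈ K to a root
-- of a polynomial over ℚ that annihilates x.  Such a root φ is constant: if r is
-- one of its values, then by cohesiveness φ is almost always r or almost always
-- a root of the polynomial divided by y - r.  So σ restricts to K.  Coordinates
-- with respect to a ℚ-basis of K are computable by search, so every element of
-- ∏K is a combination of the (constant) basis with coefficients in ∏ℚ.  This
-- makes the restriction injective, and since an automorphism of K is determined
-- by coordinates, it is computable and acts on ∏K by composition, which makes
-- the restriction surjective.
module Submission where

open import Defs
open import Algebra.Bundles using (CommutativeRing; Group)
import Algebra.Definitions.RawMonoid as RawMonoid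
import Algebra.Morphism.Construct.Composition as Composition
open import Algebra.Morphism.Structures using (IsRingHomomorphism; IsRingIsomorphism; IsGroupIsomorphism)
import Algebra.Properties.CommutativeSemigroup as CommutativeSemigroupProperties
import Algebra.Properties.Group as GroupProperties
import Algebra.Properties.Semiring.Exp as Exp
import Algebra.Properties.Semiring.Sum as Sum
import Algebra.Solver.Ring.NaturalCoefficients.Default as SemiringSolver
open import Data.Fin.Base using (Fin; zero; suc; toℕ; punchIn; punchOut)
open import Data.Fin.Patterns using (0F; 1F; 2F)
open import Data.Fin.Properties using (any?; punchIn-punchOut) renaming (_≟_ to _≟ᶠ_)
open import Data.Integer.Base using (ℤ; +_; -[1+_])
import Data.Integer.Base as ℤ
import Data.Integer.Properties as ℤ
open import Data.List.Base using (List; []; _∷_; map; length)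
open import Data.List.Extrema.Nat using (max; xs≤max)
import Data.List.Relation.Unary.All as All
open import Data.Nat.Base using (ℕ; zero; suc)
import Data.Nat.Base as ℕ
import Data.Nat.Properties as ℕ
open import Data.Product.Base using (∃; ∃₂; _×_; _,_; proj₁; proj₂)
open import Data.Rational.Base using (ℚ; 0ℚ; 1ℚ; mkℚ; toℚᵘ; 1/_; ≢-nonZero)
import Data.Rational.Base as ℚ
import Data.Rational.Properties as ℚ
import Data.Rational.Unnormalised.Base as ℚᵘ
import Data.Rational.Unnormalised.Properties as ℚᵘ
open import Data.Sum.Base using (_⊎_; inj₁; inj₂)
open import Data.Vec.Base using (Vec; []; _∷_)
open import Data.Vec.Relation.Binary.Pointwise.Inductive using ([]; _∷_)
open import Function.Base using (_∘_; id)
open import Relation.Binary.Definitions using (tri<; tri≈; tri>)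
open import Relation.Binary.PropositionalEquality using (_≡_; _≢_; cong; cong₂; subst; module ≡-Reasoning)
import Relation.Binary.PropositionalEquality as ≡
import Relation.Binary.Reasoning.Setoid as SetoidReasoning
open import Relation.Nullary.Decidable using (yes; no; ¬?; decidable-stable)
open import Relation.Nullary.Negation using (¬_; contradiction)
open import Relation.Unary using (Pred; _∈_; _∩_; ∁)

-- Codes for some total functions

module _ where
  open import Data.Nat.Base using (_+_; _*_; _∸_; _≤_; _<_; s≤s; s≤s⁻¹; pred)
  open import Data.Nat.Properties
  open ≡ using (refl; sym; trans)

  ⇓-subst : ∀ {n} {f : Code n} {xs y z} → y ≡ z → f [ xs ]⇓ y → f [ xs ]⇓ z
  ⇓-subst refl p = p

  comp₁ : ∀ {n} → Code 1 → Code n → Code n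
  comp₁ f g = comp f (g ∷ [])

  ⇓comp₁ : ∀ {n} {f : Code 1} {g : Code n} {xs y z} →
           g [ xs ]⇓ y → f [ y ∷ [] ]⇓ z → comp₁ f g [ xs ]⇓ z
  ⇓comp₁ p q = ⇓comp (p ∷ []) q

  comp₂ : ∀ {n} → Code 2 → Code n → Code n → Code n
  comp₂ f g h = comp f (g ∷ h ∷ [])

  ⇓comp₂ : ∀ {n} {f : Code 2} {g h : Code n} {xs y y′ z} →
           g [ xs ]⇓ y → h [ xs ]⇓ y′ → f [ y ∷ y′ ∷ [] ]⇓ z → comp₂ f g h [ xs ]⇓ z
  ⇓comp₂ p q r = ⇓comp (p ∷ q ∷ []) r


  addᶜ : Code 2
  addᶜ = prec (proj 0F) (comp₁ S (proj 1F))

  ⇓add : ∀ m n → addᶜ [ m ∷ n ∷ [] ]⇓ m + n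
  ⇓add zero    n = ⇓prec-zero (⇓proj _)
  ⇓add (suc m) n = ⇓prec-suc (⇓add m n) (⇓comp₁ (⇓proj _) ⇓S)

  mulᶜ : Code 2
  mulᶜ = prec Z (comp₂ addᶜ (proj 2F) (proj 1F))

  ⇓mul : ∀ m n → mulᶜ [ m ∷ n ∷ [] ]⇓ m * n
  ⇓mul zero    n = ⇓prec-zero ⇓Z
  ⇓mul (suc m) n = ⇓prec-suc (⇓mul m n) (⇓comp₂ (⇓proj _) (⇓proj _) (⇓add n (m * n)))

  predᶜ : Code 1
  predᶜ = prec Z (proj 0F)

  ⇓pred : ∀ n → predᶜ [ n ∷ [] ]⇓ pred n
  ⇓pred zero = ⇓prec-zero ⇓Z
  ⇓pred (suc n) = ⇓prec-suc (⇓pred n) (⇓proj _)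

  -- The recursion is on the number subtracted, which therefore comes first.
  monusᶜ : Code 2
  monusᶜ = prec (proj 0F) (comp₁ predᶜ (proj 1F))

  ⇓monus : ∀ m n → monusᶜ [ m ∷ n ∷ [] ]⇓ n ∸ m
  ⇓monus zero    n = ⇓prec-zero (⇓proj _)
  ⇓monus (suc m) n =
    ⇓prec-suc (⇓monus m n)
      (⇓comp₁ (⇓proj _) (⇓-subst (pred[m∸n]≡m∸[1+n] n m) (⇓pred (n ∸ m))))

  diffᶜ : Code 2
  diffᶜ = comp₂ addᶜ (comp₂ monusᶜ (proj 0F) (proj 1F)) (comp₂ monusᶜ (proj 1F) (proj 0F))

  -- The distance |m - n|. Unbounded search looks for zeros, so equality tests are put into this
  -- form.
  diff : ℕ → ℕ → ℕ
  diff m n = (n ∸ m) + (m ∸ n)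

  ⇓diff : ∀ m n → diffᶜ [ m ∷ n ∷ [] ]⇓ diff m n
  ⇓diff m n = ⇓comp₂ (⇓comp₂ (⇓proj _) (⇓proj _) (⇓monus m n))
                     (⇓comp₂ (⇓proj _) (⇓proj _) (⇓monus n m))
                     (⇓add (n ∸ m) (m ∸ n))

  diff-zero⇒≡ : ∀ {m n} → diff m n ≡ 0 → m ≡ n
  diff-zero⇒≡ {m} {n} p = ≤-antisym
    (m∸n≡0⇒m≤n (m+n≡0⇒n≡0 (n ∸ m) p)) (m∸n≡0⇒m≤n (m+n≡0⇒m≡0 (n ∸ m) p))

  ≡⇒diff-zero : ∀ {m n} → m ≡ n → diff m n ≡ 0
  ≡⇒diff-zero {m} refl = cong₂ _+_ (n∸n≡0 m) (n∸n≡0 m)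

  -- Minimality is expressed by exhibiting each earlier value as a successor, which is the form that
  -- `⇓μ` demands.
  LeastZero : (ℕ → ℕ) → ℕ → Set
  LeastZero F k = F k ≡ 0 × (∀ j → j < k → ∃ λ y → F j ≡ suc y)

  abstract
    leastZero : ∀ (F : ℕ → ℕ) {k} → F k ≡ 0 → ∃ (LeastZero F)
    leastZero F {k} Fk≡0 with below (suc k)
      where
      below : ∀ n → ∃ (LeastZero F) ⊎ (∀ j → j < n → ∃ λ y → F j ≡ suc y)
      below zero    = inj₂ λ _ ()
      below (suc n) with below n
      ... | inj₁ found = inj₁ found
      ... | inj₂ none with F n in eq
      ... | zero  = inj₁ (n , eq , none)
      ... | suc y = inj₂ λ j j<1+n → case j (m≤n⇒m<n∨m≡n (s≤s⁻¹ j<1+n))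
        where
        case : ∀ j → j < n ⊎ j ≡ n → ∃ λ y → F j ≡ suc y
        case j (inj₁ j<n)  = none j j<n
        case j (inj₂ refl) = y , eq
    ... | inj₁ found = found
    ... | inj₂ none with trans (sym Fk≡0) (proj₂ (none k ≤-refl))
    ... | ()

  ⇓leastZero : ∀ {n} {f : Code (suc n)} {xs} {F : ℕ → ℕ} → (∀ k → f [ k ∷ xs ]⇓ F k) →
               ∀ {k} → LeastZero F k → μ f [ xs ]⇓ k
  ⇓leastZero f⇓ (Fk≡0 , below) =
    ⇓μ (⇓-subst Fk≡0 (f⇓ _)) λ j j<k → proj₁ (below j j<k) , ⇓-subst (proj₂ (below j j<k)) (f⇓ j)

  -- With s = ⌊√z⌋, the number z codes the pair (z ∸ s², s ∸ (z ∸ s²)); the pair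
  -- (a , b) is coded by (a + b)² + a.
  module Pairing where

    abstract
      -- Vanishes exactly when z < (s + 1)², so its least zero is ⌊√z⌋.
      exceeds : ℕ → ℕ → ℕ
      exceeds z s = suc z ∸ suc s * suc s

      root : ∀ z → ∃ (LeastZero (exceeds z))
      -- The search ends at s = z at the latest, because z + 1 ≤ (z + 1)².
      root z = leastZero (exceeds z) {z} (m≤n⇒m∸n≡0 (m≤m*n (suc z) (suc z)))

      √ : ℕ → ℕ
      √ z = proj₁ (root z)

      √-unique : ∀ {z s} → s * s ≤ z → z < suc s * suc s → √ z ≡ s
      √-unique {z} {s} s²≤z z<[1+s]² with <-cmp (√ z) s
      ... | tri≈ _ √z≡s _ = √z≡s
      ... | tri< √z<s _ _ = contradiction
            (≤-trans (m∸n≡0⇒m≤n (proj₁ (proj₂ (root z)))) (≤-trans (*-mono-≤ √z<s √z<s) s²≤z))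
            (n≮n z)
      ... | tri> _ _ s<√z with trans (sym (m≤n⇒m∸n≡0 z<[1+s]²)) (proj₂ (proj₂ (proj₂ (root z)) s s<√z))
      ... | ()

      left right : ℕ → ℕ
      left z = z ∸ √ z * √ z
      right z = √ z ∸ left z

      √[s²+a]≡s : ∀ {a} s → a ≤ s → √ (s * s + a) ≡ s
      √[s²+a]≡s {a} s a≤s = √-unique (m≤m+n (s * s) a) (s≤s (begin
        s * s + a        ≤⟨ +-monoʳ-≤ (s * s) a≤s ⟩
        s * s + s        ≡⟨ +-comm (s * s) s ⟩
        s + s * s        ≡⟨ *-suc s s ⟨
        s * suc s        ≤⟨ m≤n+m (s * suc s) s ⟩
        s + s * suc s    ∎))
        where open ≤-Reasoning

      left[s²+a]≡a : ∀ {a} s → a ≤ s → left (s * s + a) ≡ a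
      left[s²+a]≡a {a} s a≤s =
        trans (cong (λ r → s * s + a ∸ r * r) (√[s²+a]≡s s a≤s)) (m+n∸m≡n (s * s) a)

      pairing : ∀ a b → ∃ λ z → left z ≡ a × right z ≡ b
      pairing a b = (a + b) * (a + b) + a , left[s²+a]≡a (a + b) (m≤m+n a b) ,
        trans (cong₂ _∸_ (√[s²+a]≡s (a + b) (m≤m+n a b)) (left[s²+a]≡a (a + b) (m≤m+n a b)))
              (m+n∸m≡n a b)

      √ᶜ leftᶜ rightᶜ : Code 1
      √ᶜ = μ (comp₂ monusᶜ (comp₂ mulᶜ (comp₁ S (proj 0F)) (comp₁ S (proj 0F))) (comp₁ S (proj 1F)))
      leftᶜ = comp₂ monusᶜ (comp₂ mulᶜ √ᶜ √ᶜ) (proj 0F)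
      rightᶜ = comp₂ monusᶜ leftᶜ √ᶜ

      ⇓√ : ∀ z → √ᶜ [ z ∷ [] ]⇓ √ z
      ⇓√ z = ⇓leastZero
        (λ s → ⇓comp₂ (⇓comp₂ (⇓comp₁ (⇓proj _) ⇓S) (⇓comp₁ (⇓proj _) ⇓S) (⇓mul (suc s) (suc s)))
                      (⇓comp₁ (⇓proj _) ⇓S) (⇓monus (suc s * suc s) (suc z)))
        (proj₂ (root z))

      ⇓left : ∀ z → leftᶜ [ z ∷ [] ]⇓ left z
      ⇓left z = ⇓comp₂ (⇓comp₂ (⇓√ z) (⇓√ z) (⇓mul (√ z) (√ z))) (⇓proj _) (⇓monus (√ z * √ z) z)

      ⇓right : ∀ z → rightᶜ [ z ∷ [] ]⇓ right z
      ⇓right z = ⇓comp₂ (⇓left z) (⇓√ z) (⇓monus (left z) (√ z))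

    -- Tuples are nested pairs with an arbitrary tail, for which `tuple` takes 0. Every number thus
    -- codes a tuple of each length, and a search over tuples can run through all of ℕ.
    component : ∀ {n} → Fin n → ℕ → ℕ
    component zero    z = left z
    component (suc i) z = component i (right z)

    componentᶜ : ∀ {n} → Fin n → Code 1
    componentᶜ zero    = leftᶜ
    componentᶜ (suc i) = comp₁ (componentᶜ i) rightᶜ

    ⇓component : ∀ {n} (i : Fin n) z → componentᶜ i [ z ∷ [] ]⇓ component i z
    ⇓component zero    z = ⇓left z
    ⇓component (suc i) z = ⇓comp₁ (⇓right z) (⇓component i (right z))

    tuple : ∀ {n} (a : Fin n → ℕ) → ∃ λ z → ∀ i → component i z ≡ a i
    tuple {zero}  a = 0 , λ ()
    tuple {suc n} a with tuple (a ∘ suc)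
    ... | z′ , z′≡ with pairing (a zero) z′
    ... | z , left≡ , right≡ = z , λ where
      zero    → left≡
      (suc i) → trans (cong (component i) right≡) (z′≡ i)

-- Rational linear algebra

infix 9 _·1ℚ

-- As an n-fold sum of 1, the number can be followed by primitive recursion with the addition of the
-- presentation; see `naturalᶜ`.
_·1ℚ : ℕ → ℚ
n ·1ℚ = RawMonoid._×_ ℚ.+-0-rawMonoid n 1ℚ

toℚᵘ-·1 : ∀ n → toℚᵘ (n ·1ℚ) ℚᵘ.≃ ℚᵘ.mkℚᵘ (+ n) 0
toℚᵘ-·1 zero    = ℚᵘ.≃-refl
toℚᵘ-·1 (suc n) = ℚᵘ.≃-trans (ℚ.toℚᵘ-homo-+ 1ℚ (n ·1ℚ))
  (ℚᵘ.≃-trans (ℚᵘ.+-congʳ ℚᵘ.1ℚᵘ (toℚᵘ-·1 n))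
    (ℚᵘ.*≡* (cong (ℤ._* + 1) (cong (ℤ._+_ (+ 1)) (ℤ.*-identityʳ (+ n))))))

suc·1ℚ≢0 : ∀ n → suc n ·1ℚ ≢ 0ℚ
suc·1ℚ≢0 n eq with ℚᵘ.≃-trans (ℚᵘ.≃-sym (toℚᵘ-·1 (suc n))) (ℚᵘ.≃-reflexive (cong toℚᵘ eq))
... | ℚᵘ.*≡* ()

-- With d + 1 the denominator and a, b the positive and negative parts of the numerator, q is given
-- by three natural numbers, as the enumeration `rational` requires.
clearDenominator : ∀ q → ∃ λ a → ∃₂ λ b d → q ℚ.* suc d ·1ℚ ≡ a ·1ℚ ℚ.- b ·1ℚ
clearDenominator q@(mkℚ n d _) = a , b , d , ℚ.toℚᵘ-injective (begin
  toℚᵘ (q ℚ.* suc d ·1ℚ)                           ≈⟨ ℚ.toℚᵘ-homo-* q (suc d ·1ℚ) ⟩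
  ℚᵘ.mkℚᵘ n d ℚᵘ.* toℚᵘ (suc d ·1ℚ)                ≈⟨ ℚᵘ.*-congˡ {ℚᵘ.mkℚᵘ n d} (toℚᵘ-·1 (suc d)) ⟩
  ℚᵘ.mkℚᵘ n d ℚᵘ.* ℚᵘ.mkℚᵘ (+ suc d) 0             ≈⟨ ℚᵘ.*≡* cancel ⟩
  ℚᵘ.mkℚᵘ (+ a ℤ.- + b) 0                          ≈⟨ ℚᵘ.*≡* (cong (ℤ._* + 1) difference) ⟩
  ℚᵘ.mkℚᵘ (+ a) 0 ℚᵘ.- ℚᵘ.mkℚᵘ (+ b) 0             ≈⟨ ℚᵘ.+-cong (toℚᵘ-·1 a) (ℚᵘ.-‿cong (toℚᵘ-·1 b)) ⟨
  toℚᵘ (a ·1ℚ) ℚᵘ.- toℚᵘ (b ·1ℚ)                   ≈⟨ ℚᵘ.+-congʳ (toℚᵘ (a ·1ℚ)) (ℚ.toℚᵘ-homo‿- (b ·1ℚ)) ⟨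
  toℚᵘ (a ·1ℚ) ℚᵘ.+ toℚᵘ (ℚ.- b ·1ℚ)               ≈⟨ ℚ.toℚᵘ-homo-+ (a ·1ℚ) (ℚ.- b ·1ℚ) ⟨
  toℚᵘ (a ·1ℚ ℚ.- b ·1ℚ)                           ∎)
  where
  open SetoidReasoning ℚᵘ.≃-setoid
  positivePart negativePart : ℤ → ℕ
  positivePart (+ k)    = k
  positivePart -[1+ k ] = 0
  negativePart (+ k)    = 0
  negativePart -[1+ k ] = suc k
  a = positivePart n
  b = negativePart n
  split : ∀ i → i ≡ + positivePart i ℤ.- + negativePart i
  split (+ k)    = ≡.sym (ℤ.+-identityʳ (+ k))
  split -[1+ k ] = ≡.refl
  cancel : n ℤ.* + suc d ℤ.* + 1 ≡ (+ a ℤ.- + b) ℤ.* + suc (d ℕ.* 1)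
  cancel = ≡.trans (ℤ.*-identityʳ _) (cong₂ (λ i k → i ℤ.* + suc k) (split n) (≡.sym (ℕ.*-identityʳ d)))
  difference : + a ℤ.- + b ≡ + a ℤ.* + 1 ℤ.+ (ℤ.- + b) ℤ.* + 1
  difference = ≡.sym (cong₂ ℤ._+_ (ℤ.*-identityʳ (+ a)) (ℤ.*-identityʳ (ℤ.- + b)))

module _ where
  open import Data.Rational.Base using (_+_; _*_; -_)
  open Sum (CommutativeRing.semiring ℚ.+-*-commutativeRing)
  open ≡-Reasoning

  sum-zeroˡ : ∀ {n} (v : Fin n → ℚ) → sum (λ k → 0ℚ * v k) ≡ 0ℚ
  sum-zeroˡ {n} v = ≡.trans (sum-cong-≗ (λ k → ℚ.*-zeroˡ (v k))) (sum-replicate-zero n)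

  -- A step of Gaussian elimination, in a fixed coordinate: a relation between
  -- the a k - α k t gives one between t and the a k.
  eliminate : ∀ {n} (c a α : Fin n → ℚ) t →
    - sum (λ k → c k * α k) * t + sum (λ k → c k * a k) ≡ sum (λ k → c k * (a k + - (α k * t)))
  eliminate c a α t = ≡.sym (begin
    sum (λ k → c k * (a k + - (α k * t)))
      ≡⟨ sum-cong-≗ (λ k → ≡.trans (ℚ.*-distribˡ-+ (c k) (a k) (- (α k * t)))
           (≡.trans (cong (λ s → c k * a k + c k * s) (ℚ.neg-distribʳ-* (α k) t))
             (cong (λ s → c k * a k + s) (≡.sym (ℚ.*-assoc (c k) (α k) (- t)))))) ⟩
    sum (λ k → c k * a k + c k * α k * - t)
      ≡⟨ ∑-distrib-+ (λ k → c k * a k) (λ k → c k * α k * - t) ⟩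
    sum (λ k → c k * a k) + sum (λ k → c k * α k * - t)
      ≡⟨ cong (λ s → sum (λ k → c k * a k) + s) (≡.sym (*-distribʳ-sum (- t) (λ k → c k * α k))) ⟩
    sum (λ k → c k * a k) + sum (λ k → c k * α k) * - t
      ≡⟨ ℚ.+-comm (sum (λ k → c k * a k)) _ ⟩
    sum (λ k → c k * α k) * - t + sum (λ k → c k * a k)
      ≡⟨ cong (_+ sum (λ k → c k * a k)) (≡.trans (≡.sym (ℚ.neg-distribʳ-* (sum λ k → c k * α k) t))
           (ℚ.neg-distribˡ-* (sum λ k → c k * α k) t)) ⟩
    - sum (λ k → c k * α k) * t + sum (λ k → c k * a k) ∎)

  -- Gaussian elimination, by induction on the dimension. A zero first vector is a relation by
  -- itself. Otherwise it has a pivot coordinate j; multiples of it are subtracted from the other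
  -- vectors to clear coordinate j, and the induction hypothesis applies to the results with j left
  -- out.
  dependent : ∀ n (v : Fin (suc n) → Fin n → ℚ) →
    ∃ λ (c : Fin (suc n) → ℚ) → (∃ λ k → c k ≢ 0ℚ) × ∀ j → sum (λ k → c k * v k j) ≡ 0ℚ
  dependent zero    v = (λ _ → 1ℚ) , (zero , λ ()) , λ ()
  dependent (suc n) v with any? (λ j → ¬? (v zero j ℚ.≟ 0ℚ))
  ... | no v₀≡0 = c , (zero , λ ()) , λ j → begin
    1ℚ * v zero j + sum (λ k → 0ℚ * v (suc k) j)
      ≡⟨ cong₂ (λ s r → 1ℚ * s + r)
           (decidable-stable (v zero j ℚ.≟ 0ℚ) λ v₀j≢0 → v₀≡0 (j , v₀j≢0))
           (sum-zeroˡ (λ k → v (suc k) j)) ⟩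
    0ℚ ∎
    where
    c : Fin (suc (suc n)) → ℚ
    c zero    = 1ℚ
    c (suc _) = 0ℚ
  ... | yes (j , p≢0) with dependent n (λ k l → w k (punchIn j l))
    where
    w : Fin (suc n) → Fin (suc n) → ℚ
    w k l = v (suc k) l + - (v (suc k) j * (1/ v zero j) {{≢-nonZero p≢0}} * v zero l)
  ... | c′ , (k , c′k≢0) , relation = c , (suc k , c′k≢0) , λ l → begin
    c zero * v zero l + sum (λ k → c′ k * v (suc k) l)       ≡⟨ eliminate c′ (λ k → v (suc k) l) α (v zero l) ⟩
    sum (λ k → c′ k * w k l)                                 ≡⟨ vanishes l ⟩
    0ℚ                                                       ∎
    where
    instance _ = ≢-nonZero p≢0
    α : Fin (suc n) → ℚ
    α k = v (suc k) j * 1/ v zero j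
    w : Fin (suc n) → Fin (suc n) → ℚ
    w k l = v (suc k) l + - (α k * v zero l)
    c : Fin (suc (suc n)) → ℚ
    -- This coefficient collects the multiples of the first vector that were subtracted, as in
    -- `eliminate`. The others are kept, and with them the nonzero one.
    c zero    = - sum (λ k → c′ k * α k)
    c (suc k) = c′ k
    wj≡0 : ∀ k → w k j ≡ 0ℚ
    wj≡0 k = begin
      v (suc k) j + - (v (suc k) j * 1/ v zero j * v zero j)
        ≡⟨ cong (λ s → v (suc k) j + - s) (≡.trans (ℚ.*-assoc (v (suc k) j) (1/ v zero j) (v zero j))
             (≡.trans (cong (v (suc k) j *_) (ℚ.*-inverseˡ (v zero j))) (ℚ.*-identityʳ (v (suc k) j)))) ⟩
      v (suc k) j + - v (suc k) j ≡⟨ ℚ.+-inverseʳ (v (suc k) j) ⟩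
      0ℚ ∎
    vanishes : ∀ l → sum (λ k → c′ k * w k l) ≡ 0ℚ
    -- Coordinate j was cleared; every other coordinate is `punchIn j` of one covered by the
    -- induction hypothesis.
    vanishes l with j ≟ᶠ l
    ... | no j≢l = subst (λ l → sum (λ k → c′ k * w k l) ≡ 0ℚ) (punchIn-punchOut j≢l) (relation (punchOut j≢l))
    ... | yes ≡.refl = ≡.trans (sum-cong-≗ (λ k → ≡.trans (cong (c′ k *_) (wj≡0 k)) (ℚ.*-zeroʳ (c′ k))))
                         (sum-replicate-zero (suc n))

-- Monic polynomials and division by a linear factor.

module MonicPolynomial {r ℓ} (R : CommutativeRing r ℓ) where
  open CommutativeRing R
  open SetoidReasoning setoid
  open SemiringSolver commutativeSemiring

  -- The list c₀ ∷ … ∷ cₙ₋₁ ∷ [] stands for the monic polynomial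
  -- h c₀ + h c₁ y + … + h cₙ₋₁ yⁿ⁻¹ + yⁿ.
  eval : ∀ {x} {X : Set x} → (X → Carrier) → List X → Carrier → Carrier
  eval h []      y = 1#
  eval h (c ∷ p) y = h c + y * eval h p y

  eval-cong : ∀ {x} {X : Set x} {h h′ : X → Carrier} → (∀ c → h c ≈ h′ c) →
              ∀ p {y y′} → y ≈ y′ → eval h p y ≈ eval h′ p y′
  eval-cong h≈h′ []      y≈y′ = refl
  eval-cong h≈h′ (c ∷ p) y≈y′ = +-cong (h≈h′ c) (*-cong y≈y′ (eval-cong h≈h′ p y≈y′))

  eval-map : ∀ {w x} {W : Set w} {X : Set x} (h : X → Carrier) (g : W → X) p {y} →
             eval h (map g p) y ≈ eval (h ∘ g) p y
  eval-map h g []      = refl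
  eval-map h g (c ∷ p) = +-congˡ (*-congˡ (eval-map h g p))

  -- The quotient of c ∷ p by y - r, which does not depend on c.
  quotient : Carrier → List Carrier → List Carrier
  quotient r []      = []
  quotient r (c ∷ p) = eval id (c ∷ p) r ∷ quotient r p

  -- Horner's scheme, by induction on the list. The difference y - r enters as a `d` with y = d + r,
  -- which makes this an identity of commutative semirings.
  division : ∀ c p {r d y} → y ≈ d + r →
             eval id (c ∷ p) y ≈ eval id (c ∷ p) r + d * eval id (quotient r p) y
  division c []      {r} {d} {y} y≈d+r = begin
    c + y * 1#             ≈⟨ +-congˡ (*-congʳ y≈d+r) ⟩
    c + (d + r) * 1#
      ≈⟨ solve 3 (λ c r d → c :+ (d :+ r) :* con 1 := c :+ r :* con 1 :+ d :* con 1) refl c r d ⟩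
    c + r * 1# + d * 1#    ∎
  division c (b ∷ p) {r} {d} {y} y≈d+r = begin
    c + y * E y                          ≈⟨ +-congˡ (*-congˡ E-division) ⟩
    c + y * (E r + d * Q)                ≈⟨ +-congˡ (distribˡ y (E r) (d * Q)) ⟩
    -- Only the factor of `E r` is split into d + r; the other y stays and becomes part of the
    -- quotient.
    c + (y * E r + y * (d * Q))          ≈⟨ +-congˡ (+-congʳ (*-congʳ y≈d+r)) ⟩
    c + ((d + r) * E r + y * (d * Q))
      ≈⟨ solve 6 (λ c r d y e q → c :+ ((d :+ r) :* e :+ y :* (d :* q)) := c :+ r :* e :+ d :* (e :+ y :* q))
           refl c r d y (E r) Q ⟩
    c + r * E r + d * (E r + y * Q)      ∎
    where
    E = eval id (b ∷ p)
    Q = eval id (quotient r p) y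
    E-division : E y ≈ E r + d * Q
    E-division = division b p y≈d+r

module _ {a b ℓ₁ ℓ₂} {R : CommutativeRing a ℓ₁} {S : CommutativeRing b ℓ₂} where
  private
    module R = CommutativeRing R
    module S = CommutativeRing S
    module MR = MonicPolynomial R
    module MS = MonicPolynomial S

  module _ {g} (g-homo : IsRingHomomorphism R.rawRing S.rawRing g) where
    open IsRingHomomorphism g-homo
    private
      module ΣR = Sum R.semiring
      module ΣS = Sum S.semiring

    sum-homo : ∀ {n} (x : Fin n → R.Carrier) → g (ΣR.sum x) S.≈ ΣS.sum (g ∘ x)
    sum-homo {zero}  x = 0#-homo
    sum-homo {suc n} x = S.trans (+-homo _ _) (S.+-congˡ (sum-homo (x ∘ suc)))

    eval-homo : ∀ {x} {X : Set x} {h : X → R.Carrier} p {y} →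
                g (MR.eval h p y) S.≈ MS.eval (g ∘ h) p (g y)
    eval-homo []      = 1#-homo
    eval-homo (c ∷ p) = S.trans (+-homo _ _) (S.+-congˡ (S.trans (*-homo _ _) (S.*-congˡ (eval-homo p))))

-- Elements of a number field are algebraic over ℚ.

module Algebraic {c ℓ} (𝐊 : NumberField c ℓ) where
  open NumberField 𝐊 hiding (zero)
  open Sum semiring
  open Exp semiring using (_^_)
  open MonicPolynomial commutativeRing
  open SetoidReasoning setoid
  private module ι = IsRingHomomorphism ι-isHomomorphism

  -- Lists stand for monic polynomials only, so zero coefficients at the top are dropped and the
  -- last nonzero one, u, is divided out. The recursion treats the higher coefficients first, since
  -- u comes from them if they do not all vanish.
  normalise : ∀ {m} (c : Fin m → ℚ) → (∀ k → c k ≡ 0ℚ) ⊎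
    ∃₂ λ u p → u ≢ 0ℚ × ∀ y → sum (λ k → ι (c k) * y ^ toℕ k) ≈ ι u * eval ι p y
  normalise {zero}  c = inj₁ λ ()
  normalise {suc m} c with normalise (c ∘ suc)
  ... | inj₂ (u , p , u≢0 , factor) = inj₂ (u , c₀/u ∷ p , u≢0 , λ y → begin
    ι (c zero) * 1# + sum (λ k → ι (c (suc k)) * (y * y ^ toℕ k))
      ≈⟨ +-cong (*-identityʳ _) (sum-cong-≋ λ k → x∙yz≈y∙xz (ι (c (suc k))) y (y ^ toℕ k)) ⟩
    ι (c zero) + sum (λ k → y * (ι (c (suc k)) * y ^ toℕ k))
      ≈⟨ +-congˡ (*-distribˡ-sum y (λ k → ι (c (suc k)) * y ^ toℕ k)) ⟨
    ι (c zero) + y * sum (λ k → ι (c (suc k)) * y ^ toℕ k)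
      ≈⟨ +-cong (trans (ι.⟦⟧-cong (≡.sym u*c₀/u≡c₀)) (ι.*-homo u c₀/u)) (*-congˡ (factor y)) ⟩
    ι u * ι c₀/u + y * (ι u * eval ι p y)
      ≈⟨ +-congˡ (x∙yz≈y∙xz y (ι u) (eval ι p y)) ⟩
    ι u * ι c₀/u + ι u * (y * eval ι p y)
      ≈⟨ distribˡ (ι u) (ι c₀/u) (y * eval ι p y) ⟨
    ι u * (ι c₀/u + y * eval ι p y) ∎)
    where
    open CommutativeSemigroupProperties *-commutativeSemigroup using (x∙yz≈y∙xz)
    instance _ = ≢-nonZero u≢0
    c₀/u = 1/ u ℚ.* c zero
    u*c₀/u≡c₀ : u ℚ.* c₀/u ≡ c zero
    u*c₀/u≡c₀ = ≡.trans (≡.sym (ℚ.*-assoc u (1/ u) (c zero)))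
      (≡.trans (cong (ℚ._* c zero) (ℚ.*-inverseʳ u)) (ℚ.*-identityˡ (c zero)))
  ... | inj₁ rest≡0 with c zero ℚ.≟ 0ℚ
  ...   | yes c₀≡0 = inj₁ λ { zero → c₀≡0 ; (suc k) → rest≡0 k }
  -- A nonzero constant is its own leading coefficient; the monic factor is the polynomial 1,
  -- represented by the empty list.
  ...   | no c₀≢0 = inj₂ (c zero , [] , c₀≢0 , λ y → begin
    ι (c zero) * 1# + sum (λ k → ι (c (suc k)) * (y * y ^ toℕ k))
      ≈⟨ +-congˡ (sum-cong-≋ λ k → trans (*-congʳ (trans (ι.⟦⟧-cong (rest≡0 k)) ι.0#-homo)) (zeroˡ _)) ⟩
    ι (c zero) * 1# + sum {m} (λ _ → 0#)  ≈⟨ +-congˡ (sum-replicate-zero m) ⟩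
    ι (c zero) * 1# + 0#                  ≈⟨ +-identityʳ _ ⟩
    ι (c zero) * 1#                       ∎)

  -- The powers of x from 0 to `degree` have one more coordinate vector than the dimension, so these
  -- vectors are dependent. Exchanging the two sums turns the relation between coordinates into one
  -- between the powers, which is then made monic.
  algebraic : ∀ x → ∃ λ (p : List ℚ) → eval ι p x ≈ 0#
  algebraic x with dependent degree (λ k → proj₁ (spanning (x ^ toℕ k)))
  ... | c , (k , ck≢0) , relation with normalise c
  ...   | inj₁ c≡0 = contradiction (c≡0 k) ck≢0
  ...   | inj₂ (u , p , u≢0 , factor) = p , (begin
    eval ι p x                     ≈⟨ *-identityˡ _ ⟨
    1# * eval ι p x                ≈⟨ *-congʳ (trans (ι.⟦⟧-cong (ℚ.*-inverseˡ u)) ι.1#-homo) ⟨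
    ι (1/ u ℚ.* u) * eval ι p x    ≈⟨ *-congʳ (ι.*-homo (1/ u) u) ⟩
    ι (1/ u) * ι u * eval ι p x    ≈⟨ *-assoc _ _ _ ⟩
    ι (1/ u) * (ι u * eval ι p x)  ≈⟨ *-congˡ (factor x) ⟨
    ι (1/ u) * sum (λ k → ι (c k) * x ^ toℕ k)  ≈⟨ *-congˡ Σcx≈0 ⟩
    ι (1/ u) * 0#                  ≈⟨ zeroʳ _ ⟩
    0#                             ∎)
    where
    instance _ = ≢-nonZero u≢0
    v : Fin (suc degree) → Fin degree → ℚ
    v k = proj₁ (spanning (x ^ toℕ k))
    module Σℚ = Sum (CommutativeRing.semiring ℚ.+-*-commutativeRing)
    ι-sum : ∀ {n} (q : Fin n → ℚ) → ι (Σℚ.sum q) ≈ sum (ι ∘ q)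
    ι-sum = sum-homo {R = ℚ.+-*-commutativeRing} {S = commutativeRing} ι-isHomomorphism
    Σcx≈0 : sum (λ k → ι (c k) * x ^ toℕ k) ≈ 0#
    Σcx≈0 = begin
      sum (λ k → ι (c k) * x ^ toℕ k)
        ≈⟨ sum-cong-≋ {suc degree} (λ k → *-congˡ {ι (c k)} (proj₂ (spanning (x ^ toℕ k)))) ⟩
      sum (λ k → ι (c k) * sum (λ j → ι (v k j) * basis j))
        ≈⟨ sum-cong-≋ (λ k → *-distribˡ-sum (ι (c k)) (λ j → ι (v k j) * basis j)) ⟩
      sum (λ k → sum (λ j → ι (c k) * (ι (v k j) * basis j)))
        ≈⟨ ∑-comm (λ k j → ι (c k) * (ι (v k j) * basis j)) ⟩
      sum (λ j → sum (λ k → ι (c k) * (ι (v k j) * basis j)))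
        ≈⟨ sum-cong-≋ {degree} (λ j → sum-cong-≋ {suc degree} λ k →
             trans (sym (*-assoc (ι (c k)) (ι (v k j)) (basis j))) (*-congʳ (sym (ι.*-homo (c k) (v k j))))) ⟩
      sum (λ j → sum (λ k → ι (c k ℚ.* v k j) * basis j))
        ≈⟨ sum-cong-≋ (λ j → *-distribʳ-sum (basis j) (λ k → ι (c k ℚ.* v k j))) ⟨
      sum (λ j → sum (λ k → ι (c k ℚ.* v k j)) * basis j)
        ≈⟨ sum-cong-≋ (λ j → *-congʳ (ι-sum (λ k → c k ℚ.* v k j))) ⟨
      sum (λ j → ι (Σℚ.sum (λ k → c k ℚ.* v k j)) * basis j)
        ≈⟨ sum-cong-≋ (λ j → trans (*-congʳ (trans (ι.⟦⟧-cong (relation j)) ι.0#-homo)) (zeroˡ _)) ⟩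
      sum {degree} (λ _ → 0#)
        ≈⟨ sum-replicate-zero degree ⟩
      0# ∎

-- Computing in a presentation of K

module Presentation {c ℓ} (𝐊 : NumberField c ℓ)
                    (𝒜 : ComputablePresentation (NumberField.commutativeRing 𝐊)) where
  open NumberField 𝐊 hiding (zero)
  open ComputablePresentation 𝒜
  open Sum semiring using (sum; sum-cong-≋)
  open Pairing
  module A = ComputableRing structure
  module to = IsRingIsomorphism isIsomorphism
  module ι = IsRingHomomorphism ι-isHomomorphism

  ⌜_⌝ : Carrier → ℕ
  ⌜ x ⌝ = proj₁ (to x)

  ⌜⌝-cong : ∀ {x y} → x ≈ y → ⌜ x ⌝ ≡ ⌜ y ⌝
  ⌜⌝-cong = to.⟦⟧-cong

  ⌜⌝-injective : ∀ {x y} → ⌜ x ⌝ ≡ ⌜ y ⌝ → x ≈ y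
  ⌜⌝-injective {x} {y} = to.injective {x} {y}

  ⌞_⌟ : ∀ {n} → A.Domain n → Carrier
  ⌞_⌟ {n} d = proj₁ (to.surjective (n , d))

  ⌜⌞_⌟⌝ : ∀ {n} (d : A.Domain n) → ⌜ ⌞ d ⌟ ⌝ ≡ n
  ⌜⌞_⌟⌝ {n} d = proj₂ (to.surjective (n , d)) refl

  module _ {n} {xs : Vec ℕ n} where

    ⇓-cong : ∀ {f : Code n} {x y} → x ≈ y → f [ xs ]⇓ ⌜ x ⌝ → f [ xs ]⇓ ⌜ y ⌝
    ⇓-cong x≈y = ⇓-subst (⌜⌝-cong x≈y)

    ⇓+ : ∀ {f g : Code n} {x y} → f [ xs ]⇓ ⌜ x ⌝ → g [ xs ]⇓ ⌜ y ⌝ →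
         comp₂ A.+-code f g [ xs ]⇓ ⌜ x + y ⌝
    ⇓+ {x = x} {y} p q =
      ⇓-subst (≡.sym (to.+-homo x y)) (⇓comp₂ p q (A.+-computable (to x) (to y)))

    ⇓* : ∀ {f g : Code n} {x y} → f [ xs ]⇓ ⌜ x ⌝ → g [ xs ]⇓ ⌜ y ⌝ →
         comp₂ A.*-code f g [ xs ]⇓ ⌜ x * y ⌝
    ⇓* {x = x} {y} p q =
      ⇓-subst (≡.sym (to.*-homo x y)) (⇓comp₂ p q (A.*-computable (to x) (to y)))

    ⇓neg : ∀ {f : Code n} {x} → f [ xs ]⇓ ⌜ x ⌝ → comp₁ A.neg-code f [ xs ]⇓ ⌜ - x ⌝
    ⇓neg {x = x} p = ⇓-subst (≡.sym (to.-‿homo x)) (⇓comp₁ p (A.neg-computable (to x)))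

  sumᶜ : ∀ {n m} → (Fin m → Code n) → Code n
  sumᶜ {m = zero}  f = numeral ⌜ 0# ⌝
  sumᶜ {m = suc m} f = comp₂ A.+-code (f zero) (sumᶜ (f ∘ suc))

  ⇓sum : ∀ {n m} {xs : Vec ℕ n} {f : Fin m → Code n} {x : Fin m → Carrier} →
         (∀ i → f i [ xs ]⇓ ⌜ x i ⌝) → sumᶜ f [ xs ]⇓ ⌜ sum x ⌝
  ⇓sum {m = zero}  f⇓ = ⇓numeral _
  ⇓sum {m = suc m} f⇓ = ⇓+ (f⇓ zero) (⇓sum (f⇓ ∘ suc))

  -- Replaces numbers outside the domain by 0#, which makes unbounded search
  -- over the domain possible.
  clipᶜ : Code 1
  -- Here `prec` is a case distinction on the value of χ: 0 yields the name of `0#`, and 1 yields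
  -- the number itself, which is argument 2 of the step code.
  clipᶜ = comp₂ (prec (numeral ⌜ 0# ⌝) (proj 2F)) A.χ (proj 0F)

  ⇓clip : ∀ n → ∃ λ x → clipᶜ [ n ∷ [] ]⇓ ⌜ x ⌝
  ⇓clip n with A.χ-total n
  ... | inj₁ χ⇓0 = 0# , ⇓comp₂ χ⇓0 (⇓proj _) (⇓prec-zero (⇓numeral _))
  ... | inj₂ χ⇓1 = ⌞ χ⇓1 ⌟ , ⇓-subst (≡.sym ⌜⌞ χ⇓1 ⌟⌝)
        (⇓comp₂ χ⇓1 (⇓proj _) (⇓prec-suc (⇓prec-zero (⇓numeral _)) (⇓proj _)))

  ⇓clip-⌜⌝ : ∀ x → clipᶜ [ ⌜ x ⌝ ∷ [] ]⇓ ⌜ x ⌝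
  ⇓clip-⌜⌝ x =
    ⇓comp₂ (proj₂ (to x)) (⇓proj _) (⇓prec-suc (⇓prec-zero (⇓numeral _)) (⇓proj _))

  naturalᶜ : Code 1
  naturalᶜ = prec (numeral ⌜ ι 0ℚ ⌝) (comp₂ A.+-code (numeral ⌜ ι 1ℚ ⌝) (proj 1F))

  ⇓natural : ∀ n → naturalᶜ [ n ∷ [] ]⇓ ⌜ ι (n ·1ℚ) ⌝
  ⇓natural zero    = ⇓prec-zero (⇓numeral _)
  ⇓natural (suc n) = ⇓prec-suc (⇓natural n)
    (⇓-cong (sym (ι.+-homo 1ℚ (n ·1ℚ))) (⇓+ (⇓numeral ⌜ ι 1ℚ ⌝) (⇓proj _)))

  abstract
    1/suc : ℕ → ℚ
    1/suc n = (1/ suc n ·1ℚ) {{≢-nonZero (suc·1ℚ≢0 n)}}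

    suc*1/suc : ∀ n → suc n ·1ℚ ℚ.* 1/suc n ≡ 1ℚ
    suc*1/suc n = ℚ.*-inverseʳ (suc n ·1ℚ) {{≢-nonZero (suc·1ℚ≢0 n)}}

  -- Inversion is not an operation of the presentation, so 1/(n + 1) is searched for. Argument 0 is
  -- the candidate, argument 1 is n.
  inverseTestᶜ : Code 2
  inverseTestᶜ = comp₂ diffᶜ
    (comp₂ A.*-code (comp₁ naturalᶜ (comp₁ S (proj 1F))) (comp₁ clipᶜ (proj 0F)))
    (numeral ⌜ 1# ⌝)

  1/sucᶜ : Code 1
  1/sucᶜ = comp₁ clipᶜ (μ inverseTestᶜ)

  -- The search ends because the name of the inverse passes the test. Whatever number it finds, the
  -- clipped value is an inverse of n + 1, and inverses are unique.
  ⇓1/suc : ∀ n → 1/sucᶜ [ n ∷ [] ]⇓ ⌜ ι (1/suc n) ⌝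
  ⇓1/suc n = ⇓comp₁ (⇓leastZero ⇓test (proj₂ found)) (⇓-cong clip≈ (proj₂ (⇓clip k)))
    where
    d = suc n ·1ℚ
    clip : ℕ → Carrier
    clip y = proj₁ (⇓clip y)
    test : ℕ → ℕ
    test y = diff ⌜ ι d * clip y ⌝ ⌜ 1# ⌝
    ⇓test : ∀ y → inverseTestᶜ [ y ∷ n ∷ [] ]⇓ test y
    ⇓test y = ⇓comp₂ (⇓* (⇓comp₁ (⇓comp₁ (⇓proj _) ⇓S) (⇓natural (suc n)))
                         (⇓comp₁ (⇓proj _) (proj₂ (⇓clip y))))
                     (⇓numeral ⌜ 1# ⌝) (⇓diff ⌜ ι d * clip y ⌝ ⌜ 1# ⌝)
    ιd*ι1/d≈1 : ι d * ι (1/suc n) ≈ 1#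
    ιd*ι1/d≈1 = trans (sym (ι.*-homo d (1/suc n))) (trans (ι.⟦⟧-cong (suc*1/suc n)) ι.1#-homo)
    clip-⌜⌝ : ∀ x → clip ⌜ x ⌝ ≈ x
    clip-⌜⌝ x = ⌜⌝-injective (⇓-deterministic (proj₂ (⇓clip ⌜ x ⌝)) (⇓clip-⌜⌝ x))
    found = leastZero test {⌜ ι (1/suc n) ⌝}
      (≡⇒diff-zero (⌜⌝-cong (trans (*-congˡ (clip-⌜⌝ _)) ιd*ι1/d≈1)))
    k = proj₁ found
    ιd*clip≈1 : ι d * clip k ≈ 1#
    ιd*clip≈1 = ⌜⌝-injective (diff-zero⇒≡ (proj₁ (proj₂ found)))
    open SetoidReasoning setoid
    clip≈ : clip k ≈ ι (1/suc n)
    clip≈ = begin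
      clip k                       ≈⟨ *-identityʳ _ ⟨
      clip k * 1#                  ≈⟨ *-congˡ ιd*ι1/d≈1 ⟨
      clip k * (ι d * ι (1/suc n)) ≈⟨ *-assoc _ _ _ ⟨
      clip k * ι d * ι (1/suc n)   ≈⟨ *-congʳ (trans (*-comm _ _) ιd*clip≈1) ⟩
      1# * ι (1/suc n)             ≈⟨ *-identityˡ _ ⟩
      ι (1/suc n)                  ∎

  -- An enumeration of ℚ with repetitions: z codes a triple (a , b , d) and stands for (a - b)/(d +
  -- 1).
  rational : ℕ → ℚ
  rational z = (component {3} 0F z ·1ℚ ℚ.- component {3} 1F z ·1ℚ) ℚ.* 1/suc (component {3} 2F z)

  rational-surjective : ∀ q → ∃ λ z → rational z ≡ q
  rational-surjective q with clearDenominator q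
  ... | a , b , d , q*d≡a-b with tuple {3} (λ { 0F → a ; 1F → b ; 2F → d })
  ... | z , z≡ = z , (begin
    rational z
      ≡⟨ cong₂ (λ r t → (r ·1ℚ ℚ.- t ·1ℚ) ℚ.* 1/suc (component {3} 2F z)) (z≡ 0F) (z≡ 1F) ⟩
    (a ·1ℚ ℚ.- b ·1ℚ) ℚ.* 1/suc (component {3} 2F z)
      ≡⟨ cong₂ (λ r t → r ℚ.* 1/suc t) (≡.sym q*d≡a-b) (z≡ 2F) ⟩
    q ℚ.* suc d ·1ℚ ℚ.* 1/suc d               ≡⟨ ℚ.*-assoc q (suc d ·1ℚ) (1/suc d) ⟩
    q ℚ.* (suc d ·1ℚ ℚ.* 1/suc d)             ≡⟨ cong (q ℚ.*_) (suc*1/suc d) ⟩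
    q ℚ.* 1ℚ                                  ≡⟨ ℚ.*-identityʳ q ⟩
    q                                         ∎)
    where open ≡-Reasoning

  rationalᶜ : Code 1
  rationalᶜ = comp₂ A.*-code
    (comp₂ A.+-code (comp₁ naturalᶜ (componentᶜ {3} 0F))
                    (comp₁ A.neg-code (comp₁ naturalᶜ (componentᶜ {3} 1F))))
    (comp₁ 1/sucᶜ (componentᶜ {3} 2F))

  ⇓rational : ∀ z → rationalᶜ [ z ∷ [] ]⇓ ⌜ ι (rational z) ⌝
  ⇓rational z = ⇓-cong (sym ι-rational)
    (⇓* (⇓+ (⇓comp₁ (⇓component {3} 0F z) (⇓natural _))
            (⇓neg (⇓comp₁ (⇓component {3} 1F z) (⇓natural _))))
        (⇓comp₁ (⇓component {3} 2F z) (⇓1/suc _)))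
    where
    ι-rational = trans (ι.*-homo _ _)
      (*-congʳ (trans (ι.+-homo _ _) (+-congˡ (ι.-‿homo (component {3} 1F z ·1ℚ)))))

  combination : (Fin degree → ℚ) → Carrier
  combination q = sum (λ i → ι (q i) * basis i)

  coordinateTestᶜ : Code 2
  coordinateTestᶜ = comp₂ diffᶜ
    (sumᶜ λ i → comp₂ A.*-code (comp₁ rationalᶜ (comp₁ (componentᶜ i) (proj 0F))) (numeral ⌜ basis i ⌝))
    (proj 1F)

  coordinateᶜ : Fin degree → Code 1
  coordinateᶜ i = comp₁ rationalᶜ (comp₁ (componentᶜ i) (μ coordinateTestᶜ))

  abstract
    -- All tuples of rationals are tried until one combines to x. The coordinates supplied by
    -- `spanning` only show that the search ends; those returned are the ones it finds, so
    -- `coordinateᶜ` computes them by construction.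
    coordinates : ∀ x → ∃ λ q → x ≈ combination q × ∀ i → coordinateᶜ i [ ⌜ x ⌝ ∷ [] ]⇓ ⌜ ι (q i) ⌝
    coordinates x = q k , sym (⌜⌝-injective (diff-zero⇒≡ (proj₁ (proj₂ found)))) , λ i →
        ⇓comp₁ (⇓comp₁ (⇓leastZero ⇓test (proj₂ found)) (⇓component i k)) (⇓rational (component i k))
      where
      q : ℕ → Fin degree → ℚ
      q z i = rational (component i z)
      test : ℕ → ℕ
      test z = diff ⌜ combination (q z) ⌝ ⌜ x ⌝
      ⇓test : ∀ z → coordinateTestᶜ [ z ∷ ⌜ x ⌝ ∷ [] ]⇓ test z
      ⇓test z = ⇓comp₂
        (⇓sum {x = λ i → ι (q z i) * basis i} λ i →
          ⇓* (⇓comp₁ (⇓comp₁ (⇓proj _) (⇓component i z)) (⇓rational (component i z))) (⇓numeral ⌜ basis i ⌝))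
        (⇓proj _) (⇓diff ⌜ combination (q z) ⌝ ⌜ x ⌝)
      q₀ : Fin degree → ℚ
      q₀ = proj₁ (spanning x)
      code₀ : ∃ λ z → ∀ i → component i z ≡ proj₁ (rational-surjective (q₀ i))
      code₀ = tuple λ i → proj₁ (rational-surjective (q₀ i))
      q-code₀ : ∀ i → q (proj₁ code₀) i ≡ q₀ i
      q-code₀ i = ≡.trans (cong rational (proj₂ code₀ i)) (proj₂ (rational-surjective (q₀ i)))
      found : ∃ (LeastZero test)
      found = leastZero test {proj₁ code₀} (≡⇒diff-zero (⌜⌝-cong
        (trans (sum-cong-≋ {degree} (λ i → *-congʳ (ι.⟦⟧-cong (q-code₀ i)))) (sym (proj₂ (spanning x))))))
      k : ℕ
      k = proj₁ found

-- The cohesive power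

⊆*-meets : ∀ {a b} {A : Pred ℕ a} {B : Pred ℕ b} → Infinite A → A ⊆* B → ∃ λ n → n ∈ A × n ∈ B
-- An element of A beyond the maximum of the exceptional list F cannot be an exception.
⊆*-meets infinite (F , cover) with infinite (suc (max 0 F))
... | n , F<n , n∈A with cover n∈A
... | inj₁ n∈B = n , n∈A , n∈B
... | inj₂ n∈F = contradiction (All.lookup (xs≤max 0 F) n∈F) (ℕ.<⇒≱ F<n)

module CohesivePower {c ℓ p} (𝐊 : NumberField c ℓ)
    (𝒜 : ComputablePresentation (NumberField.commutativeRing 𝐊))
    (C : Pred ℕ p) (cohesive : Cohesive C) where
  open NumberField 𝐊 hiding (zero)
  open ComputablePresentation 𝒜
  open Presentation 𝐊 𝒜
  open Cohesive cohesive
  open Algebraic 𝐊 using (algebraic)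
  module P = Power C structure
  open P using (Element; code; values; defined; agree; constant)
  module ∏K = CommutativeRing P.commutativeRing
  open MonicPolynomial commutativeRing
  open GroupProperties +-group using (//-rightDividesˡ; x∙y⁻¹≈ε⇒x≈y)

  infix 4 _at_↓_

  _at_↓_ : Element → ℕ → Carrier → Set
  φ at i ↓ x = code φ [ i ∷ [] ]⇓ ⌜ x ⌝

  converges : ∀ φ → C ⊆* λ i → ∃ λ x → φ at i ↓ x
  converges φ = ⊆*-map (λ { (_ , φ⇓) → ⌞ values φ φ⇓ ⌟ , ⇓-subst (≡.sym ⌜⌞ values φ φ⇓ ⌟⌝) φ⇓ }) (defined φ)

  fromValues : ∀ {φ ψ} → C ⊆* (λ i → ∃ λ x → φ at i ↓ x × ψ at i ↓ x) → φ P.≈ ψ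
  fromValues a = agree (⊆*-map (λ { (x , φ⇓ , ψ⇓) → ⌜ x ⌝ , φ⇓ , ψ⇓ }) a)

  toValues : ∀ {φ ψ} → φ P.≈ ψ → C ⊆* (λ i → ∃ λ x → φ at i ↓ x × ψ at i ↓ x)
  toValues {φ} (agree a) = ⊆*-map
    (λ { (y , φ⇓ , ψ⇓) → ⌞ values φ φ⇓ ⌟ , ⇓-subst (≡.sym ⌜⌞ values φ φ⇓ ⌟⌝) φ⇓
                                         , ⇓-subst (≡.sym ⌜⌞ values φ φ⇓ ⌟⌝) ψ⇓ }) a

  -- The canonical embedding of K into its cohesive power.
  const : Carrier → Element
  const x = constant (to x)

  const↓ : ∀ x {i} → const x at i ↓ x
  const↓ x = ⇓numeral ⌜ x ⌝

  everywhere : ∀ {φ ψ} {x : ℕ → Carrier} → (∀ i → φ at i ↓ x i) → (∀ i → ψ at i ↓ x i) → φ P.≈ ψ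
  everywhere φ⇓ ψ⇓ = fromValues (⊆*-always λ i → _ , φ⇓ i , ψ⇓ i)

  const-isHomomorphism : IsRingHomomorphism rawRing ∏K.rawRing const
  const-isHomomorphism = record
    { isSemiringHomomorphism = record
      { isNearSemiringHomomorphism = record
        { +-isMonoidHomomorphism = record
          { isMagmaHomomorphism = record
            { isRelHomomorphism = record
              { cong = λ {x} {y} x≈y → everywhere {const x} {const y} {λ _ → x} (λ _ → const↓ x)
                         (λ _ → ⇓-cong (sym x≈y) (const↓ y)) }
            ; homo = λ x y → everywhere {const (x + y)} {const x P.+ const y} {λ _ → x + y}
                       (λ _ → const↓ _) (λ _ → ⇓+ (const↓ x) (const↓ y))
            }
          -- The zero of the power is built from the zero of the presentation, not from the image of
          -- the zero of K; `to` identifies the two.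
          ; ε-homo = agree (⊆*-always λ _ → _ , const↓ 0# , ⇓-subst (≡.sym to.0#-homo) (⇓numeral _))
          }
        ; *-homo = λ x y → everywhere {const (x * y)} {const x P.* const y} {λ _ → x * y}
                     (λ _ → const↓ _) (λ _ → ⇓* (const↓ x) (const↓ y))
        }
      ; 1#-homo = agree (⊆*-always λ _ → _ , const↓ 1# , ⇓-subst (≡.sym to.1#-homo) (⇓numeral _))
      }
    ; -‿homo = λ x → everywhere {const (- x)} {P.- const x} {λ _ → - x}
                       (λ _ → const↓ _) (λ _ → ⇓neg (const↓ x))
    }

  module const = IsRingHomomorphism const-isHomomorphism

  -- As C is infinite, agreement almost everywhere yields an index at which the two constants
  -- coincide.
  const-injective : ∀ {x y} → const x P.≈ const y → x ≈ y
  const-injective x≈y with ⊆*-meets infinite (toValues x≈y)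
  ... | i , _ , z , x⇓z , y⇓z = trans
    (⌜⌝-injective (⇓-deterministic (const↓ _) x⇓z)) (⌜⌝-injective (⇓-deterministic y⇓z (const↓ _)))

  -- Roots of polynomials over K in the power.

  module M∏ = MonicPolynomial P.commutativeRing

  eval↓ : ∀ {x} {X : Set x} {h : X → Carrier} p {φ i y} → φ at i ↓ y →
          M∏.eval (const ∘ h) p φ at i ↓ eval h p y
  eval↓ []      φ⇓ = ⇓-subst (≡.sym to.1#-homo) (⇓numeral _)
  eval↓ (c ∷ p) φ⇓ = ⇓+ (const↓ _) (⇓* φ⇓ (eval↓ p φ⇓))

  -- Cohesiveness applies to domains of codes, so the set where φ takes the value r is made into
  -- one. The test ignores the search variable: the search stops at 0 where φ has value r and
  -- diverges everywhere else.
  fiberᶜ : Element → Carrier → Code 1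
  fiberᶜ φ r = μ (comp₂ diffᶜ (comp₁ (code φ) (proj 1F)) (numeral ⌜ r ⌝))

  fiber⇒value : ∀ {φ r i} → i ∈ dom (fiberᶜ φ r) → φ at i ↓ r
  fiber⇒value {φ} {r} (_ , ⇓μ (⇓comp (⇓comp (⇓proj _ ∷ []) φ⇓ ∷ r⇓ ∷ []) diff⇓0) _)
    with ⇓-deterministic r⇓ (⇓numeral ⌜ r ⌝)
  ... | ≡.refl = ⇓-subst (diff-zero⇒≡ (⇓-deterministic (⇓diff _ _) diff⇓0)) φ⇓

  value⇒fiber : ∀ {φ r i} → φ at i ↓ r → i ∈ dom (fiberᶜ φ r)
  value⇒fiber {φ} {r} φ⇓ = 0 , ⇓μ
    (⇓comp₂ (⇓comp₁ (⇓proj _) φ⇓) (⇓numeral ⌜ r ⌝)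
      (⇓-subst (≡⇒diff-zero {⌜ r ⌝} ≡.refl) (⇓diff ⌜ r ⌝ ⌜ r ⌝)))
    (λ _ ())

  *-cancelˡ-0 : ∀ {x y} → ¬ x ≈ 0# → x * y ≈ 0# → y ≈ 0#
  *-cancelˡ-0 {x} {y} x≉0 xy≈0 with inverse x x≉0
  ... | x⁻¹ , xx⁻¹≈1 = begin
    y              ≈⟨ *-identityˡ y ⟨
    1# * y         ≈⟨ *-congʳ xx⁻¹≈1 ⟨
    x * x⁻¹ * y    ≈⟨ *-congʳ (*-comm x x⁻¹) ⟩
    x⁻¹ * x * y    ≈⟨ *-assoc x⁻¹ x y ⟩
    x⁻¹ * (x * y)  ≈⟨ *-congˡ xy≈0 ⟩
    x⁻¹ * 0#       ≈⟨ zeroʳ x⁻¹ ⟩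
    0#             ∎
    where open SetoidReasoning setoid

  RootAt : Element → List Carrier → Pred ℕ _
  RootAt φ p i = ∃ λ y → φ at i ↓ y × eval id p y ≈ 0#

  -- Some value r taken by φ on C is a root of p.  By cohesiveness φ is almost
  -- always equal to r, or almost always different from r and hence a root of
  -- p / (y - r).
  root⇒constant : ∀ φ p → C ⊆* RootAt φ p → ∃ λ r → const r P.≈ φ
  root⇒constant φ p = go (length p) p ≡.refl
    where
    length-quotient : ∀ r q → length (quotient r q) ≡ length q
    length-quotient r []      = ≡.refl
    length-quotient r (c ∷ q) = cong suc (length-quotient r q)

    -- The recursion is on the length, since `quotient r q` is not a part of `q`.
    go : ∀ n q → length q ≡ n → C ⊆* RootAt φ q → ∃ λ r → const r P.≈ φ
    go n [] _ root with ⊆*-meets infinite root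
    ... | _ , _ , _ , _ , 1≈0 = contradiction (sym 1≈0) 0≉1
    go (suc n) (c ∷ q) len root with ⊆*-meets infinite root
    ... | _ , _ , r , _ , r-root with indivisible (fiberᶜ φ r)
    ... | inj₁ φ≡r = r , fromValues (⊆*-map (λ i∈ → r , const↓ r , fiber⇒value {φ} i∈) φ≡r)
    ... | inj₂ φ≢r = go n (quotient r q) (≡.trans (length-quotient r q) (ℕ.suc-injective len))
                        (⊆*-map divide (⊆*-∩ root φ≢r))
      where
      divide : ∀ {i} → i ∈ (RootAt φ (c ∷ q) ∩ ∁ (dom (fiberᶜ φ r))) → i ∈ RootAt φ (quotient r q)
      divide ((y , φ⇓y , y-root) , i∉) = y , φ⇓y , *-cancelˡ-0 y-r≉0 (begin
        (y - r) * eval id (quotient r q) y                        ≈⟨ +-identityˡ _ ⟨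
        0# + (y - r) * eval id (quotient r q) y                   ≈⟨ +-congʳ r-root ⟨
        eval id (c ∷ q) r + (y - r) * eval id (quotient r q) y    ≈⟨ division c q (sym (//-rightDividesˡ r y)) ⟨
        eval id (c ∷ q) y                                         ≈⟨ y-root ⟩
        0#                                                        ∎)
        where
        open SetoidReasoning setoid
        y-r≉0 : ¬ y - r ≈ 0#
        y-r≉0 y-r≈0 = i∉ (value⇒fiber {φ} (⇓-cong (x∙y⁻¹≈ε⇒x≈y y r y-r≈0) φ⇓y))

  Aut∏ AutK : Group _ _
  Aut∏ = Aut P.commutativeRing (∏ℚ 𝐊 𝒜 C)
  AutK = Aut commutativeRing rationals
  module Aut∏ = Group Aut∏
  module AutK = Group AutK

  module Restriction (σ : Aut∏.Carrier) where
    private module σ = Automorphism σ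
    open σ using (⟦_⟧)

    const-rational : ∀ q → const (ι q) ∈ ∏ℚ 𝐊 𝒜 C
    const-rational q = const (ι q) , (λ ⇓y → q , ⇓-deterministic (const↓ (ι q)) ⇓y) , P.≈-refl

    σ-root : ∀ x → ∃ λ p → C ⊆* RootAt ⟦ const x ⟧ p
    σ-root x with algebraic x
    ... | p , px≈0 = map ι p , ⊆*-map atIndex (⊆*-∩ (converges ⟦ const x ⟧) (toValues p[σx]≈0))
      where
      open SetoidReasoning ∏K.setoid
      p[σx]≈0 : M∏.eval (const ∘ ι) p ⟦ const x ⟧ P.≈ const 0#
      p[σx]≈0 = begin
        M∏.eval (const ∘ ι) p ⟦ const x ⟧
          ≈⟨ M∏.eval-cong (λ q → σ.fixes (const (ι q)) (const-rational q)) p ∏K.refl ⟨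
        M∏.eval (⟦_⟧ ∘ const ∘ ι) p ⟦ const x ⟧
          ≈⟨ eval-homo {R = commutativeRing} {S = P.commutativeRing}
               (Composition.isRingHomomorphism ∏K.trans const-isHomomorphism σ.isRingHomomorphism) p ⟨
        ⟦ const (eval ι p x) ⟧  ≈⟨ σ.⟦⟧-cong (const.⟦⟧-cong px≈0) ⟩
        ⟦ const 0# ⟧            ≈⟨ σ.⟦⟧-cong const.0#-homo ⟩
        ⟦ P.0# ⟧                ≈⟨ σ.0#-homo ⟩
        P.0#                    ≈⟨ const.0#-homo ⟨
        const 0#                ∎
      atIndex : ∀ {i} → i ∈ ((λ i → ∃ λ y → ⟦ const x ⟧ at i ↓ y) ∩
                             (λ i → ∃ λ z → M∏.eval (const ∘ ι) p ⟦ const x ⟧ at i ↓ z × const 0# at i ↓ z)) →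
                i ∈ RootAt ⟦ const x ⟧ (map ι p)
      atIndex ((y , σx⇓y) , (z , p⇓z , 0⇓z)) = y , σx⇓y , trans (eval-map id ι p)
        (trans (⌜⌝-injective (⇓-deterministic (eval↓ p σx⇓y) p⇓z))
               (⌜⌝-injective (⇓-deterministic 0⇓z (const↓ 0#))))

    abstract
      restrict : Carrier → Carrier
      restrict x = proj₁ (root⇒constant ⟦ const x ⟧ (proj₁ (σ-root x)) (proj₂ (σ-root x)))

      const-restrict : ∀ x → const (restrict x) P.≈ ⟦ const x ⟧
      const-restrict x = proj₂ (root⇒constant ⟦ const x ⟧ (proj₁ (σ-root x)) (proj₂ (σ-root x)))

    restrict-unique : ∀ {x y} → ⟦ const x ⟧ P.≈ const y → restrict x ≈ y
    restrict-unique σx≈y = const-injective (∏K.trans (const-restrict _) σx≈y)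

    const-fixed : ∀ {x} → x ∈ rationals → ⟦ const x ⟧ P.≈ const x
    const-fixed {x} (q , ιq≈x) = begin
      ⟦ const x ⟧      ≈⟨ σ.⟦⟧-cong (const.⟦⟧-cong ιq≈x) ⟨
      ⟦ const (ι q) ⟧  ≈⟨ σ.fixes (const (ι q)) (const-rational q) ⟩
      const (ι q)      ≈⟨ const.⟦⟧-cong ιq≈x ⟩
      const x          ∎
      where open SetoidReasoning ∏K.setoid

    restrict-isHomomorphism : IsRingHomomorphism rawRing rawRing restrict
    restrict-isHomomorphism = record
      { isSemiringHomomorphism = record
        { isNearSemiringHomomorphism = record
          { +-isMonoidHomomorphism = record
            { isMagmaHomomorphism = record
              { isRelHomomorphism = record
                { cong = λ x≈y → restrict-unique
                    (∏K.trans (σ.⟦⟧-cong (const.⟦⟧-cong x≈y)) (∏K.sym (const-restrict _))) }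
              ; homo = λ x y → restrict-unique (begin
                  ⟦ const (x + y) ⟧                        ≈⟨ σ.⟦⟧-cong (const.+-homo x y) ⟩
                  ⟦ const x P.+ const y ⟧                  ≈⟨ σ.+-homo (const x) (const y) ⟩
                  ⟦ const x ⟧ P.+ ⟦ const y ⟧              ≈⟨ ∏K.+-cong (const-restrict x) (const-restrict y) ⟨
                  const (restrict x) P.+ const (restrict y) ≈⟨ const.+-homo (restrict x) (restrict y) ⟨
                  const (restrict x + restrict y)          ∎)
              }
            ; ε-homo = restrict-unique (begin
                ⟦ const 0# ⟧  ≈⟨ σ.⟦⟧-cong const.0#-homo ⟩
                ⟦ P.0# ⟧      ≈⟨ σ.0#-homo ⟩
                P.0#          ≈⟨ const.0#-homo ⟨
                const 0#      ∎)
            }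
          ; *-homo = λ x y → restrict-unique (begin
              ⟦ const (x * y) ⟧                        ≈⟨ σ.⟦⟧-cong (const.*-homo x y) ⟩
              ⟦ const x P.* const y ⟧                  ≈⟨ σ.*-homo (const x) (const y) ⟩
              ⟦ const x ⟧ P.* ⟦ const y ⟧              ≈⟨ ∏K.*-cong (const-restrict x) (const-restrict y) ⟨
              const (restrict x) P.* const (restrict y) ≈⟨ const.*-homo (restrict x) (restrict y) ⟨
              const (restrict x * restrict y)          ∎)
          }
        ; 1#-homo = restrict-unique (begin
            ⟦ const 1# ⟧  ≈⟨ σ.⟦⟧-cong const.1#-homo ⟩
            ⟦ P.1# ⟧      ≈⟨ σ.1#-homo ⟩
            P.1#          ≈⟨ const.1#-homo ⟨
            const 1#      ∎)
        }
      ; -‿homo = λ x → restrict-unique (begin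
          ⟦ const (- x) ⟧       ≈⟨ σ.⟦⟧-cong (const.-‿homo x) ⟩
          ⟦ P.- const x ⟧       ≈⟨ σ.-‿homo (const x) ⟩
          P.- ⟦ const x ⟧       ≈⟨ ∏K.-‿cong (const-restrict x) ⟨
          P.- const (restrict x) ≈⟨ const.-‿homo (restrict x) ⟨
          const (- restrict x)  ∎)
      }
      where open SetoidReasoning ∏K.setoid

    restrict-injective : ∀ {x y} → restrict x ≈ restrict y → x ≈ y
    restrict-injective {x} {y} rx≈ry = const-injective (σ.injective (begin
      ⟦ const x ⟧         ≈⟨ const-restrict x ⟨
      const (restrict x)  ≈⟨ const.⟦⟧-cong rx≈ry ⟩
      const (restrict y)  ≈⟨ const-restrict y ⟩
      ⟦ const y ⟧         ∎))
      where open SetoidReasoning ∏K.setoid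

  open Restriction using (restrict; const-restrict; restrict-unique)

  restrict-∘ : ∀ σ τ x → restrict (σ Aut∏.∙ τ) x ≈ restrict σ (restrict τ x)
  restrict-∘ σ τ x = restrict-unique (σ Aut∏.∙ τ) (∏K.trans
    (Automorphism.⟦⟧-cong σ (∏K.sym (const-restrict τ x))) (∏K.sym (const-restrict σ (restrict τ x))))

  restrict-inverseʳ : ∀ σ x → restrict σ (restrict (σ Aut∏.⁻¹) x) ≈ x
  restrict-inverseʳ σ x = trans (sym (restrict-∘ σ (σ Aut∏.⁻¹) x))
    (restrict-unique (σ Aut∏.∙ σ Aut∏.⁻¹) (Aut∏.inverseʳ σ (const x)))

  restriction : Aut∏.Carrier → AutK.Carrier
  restriction σ = record
    { ⟦_⟧               = restrict σ
    ; isRingIsomorphism = record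
      { isRingMonomorphism = record
        { isRingHomomorphism = restrict-isHomomorphism
        ; injective          = restrict-injective
        }
      ; surjective = λ y → restrict (σ Aut∏.⁻¹) y ,
          λ z≈ → trans (IsRingHomomorphism.⟦⟧-cong restrict-isHomomorphism z≈) (restrict-inverseʳ σ y)
      }
    ; fixes = λ x x∈ℚ → restrict-unique σ (const-fixed x∈ℚ)
    }
    where open Restriction σ hiding (restrict; restrict-unique)

  lift₁ : ∀ φ {α β} {f : Carrier → Carrier} →
          (∀ {i x} → φ at i ↓ x → α at i ↓ f x × β at i ↓ f x) → α P.≈ β
  lift₁ φ f⇓ = fromValues (⊆*-map (λ { (x , φ⇓) → _ , f⇓ φ⇓ }) (converges φ))

  lift₂ : ∀ φ ψ {α β} {f : Carrier → Carrier → Carrier} →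
          (∀ {i x y} → φ at i ↓ x → ψ at i ↓ y → α at i ↓ f x y × β at i ↓ f x y) → α P.≈ β
  lift₂ φ ψ f⇓ = fromValues
    (⊆*-map (λ { ((x , φ⇓) , (y , ψ⇓)) → _ , f⇓ φ⇓ ψ⇓ }) (⊆*-∩ (converges φ) (converges ψ)))

  module Extension (τ : AutK.Carrier) where
    private module τ = Automorphism τ
    open τ using (⟦_⟧)
    open Sum semiring using (sum; sum-cong-≋)

    τᶜ : Code 1
    τᶜ = sumᶜ λ i → comp₂ A.*-code (coordinateᶜ i) (numeral ⌜ ⟦ basis i ⟧ ⌝)

    ⇓τ : ∀ x → τᶜ [ ⌜ x ⌝ ∷ [] ]⇓ ⌜ ⟦ x ⟧ ⌝
    ⇓τ x with coordinates x
    ... | q , x≈ , q⇓ = ⇓-cong (sym τx≈)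
      (⇓sum {x = λ i → ι (q i) * ⟦ basis i ⟧} λ i → ⇓* (q⇓ i) (⇓numeral ⌜ ⟦ basis i ⟧ ⌝))
      where
      open SetoidReasoning setoid
      τx≈ : ⟦ x ⟧ ≈ sum (λ i → ι (q i) * ⟦ basis i ⟧)
      τx≈ = begin
        ⟦ x ⟧                                 ≈⟨ τ.⟦⟧-cong x≈ ⟩
        ⟦ combination q ⟧
          ≈⟨ sum-homo {R = commutativeRing} {S = commutativeRing} τ.isRingHomomorphism (λ i → ι (q i) * basis i) ⟩
        sum (λ i → ⟦ ι (q i) * basis i ⟧)
          ≈⟨ sum-cong-≋ {degree} (λ i → trans (τ.*-homo (ι (q i)) (basis i))
               (*-congʳ {⟦ basis i ⟧} (τ.fixes (ι (q i)) (q i , refl)))) ⟩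
        sum (λ i → ι (q i) * ⟦ basis i ⟧)     ∎

    extend : Element → Element
    extend = P.pointwise₁ τᶜ (λ x → to ⟦ ⌞ proj₂ x ⌟ ⟧)
      (λ x → subst (λ n → τᶜ [ n ∷ [] ]⇓ ⌜ ⟦ ⌞ proj₂ x ⌟ ⟧ ⌝) ⌜⌞ proj₂ x ⌟⌝ (⇓τ ⌞ proj₂ x ⌟))

    extend↓ : ∀ {φ i x} → φ at i ↓ x → extend φ at i ↓ ⟦ x ⟧
    extend↓ {x = x} φ⇓ = ⇓comp₁ φ⇓ (⇓τ x)

    extend-const : ∀ x → extend (const x) P.≈ const ⟦ x ⟧
    extend-const x = everywhere {extend (const x)} {const ⟦ x ⟧} {λ _ → ⟦ x ⟧}
      (λ _ → extend↓ {const x} (const↓ x)) (λ _ → const↓ ⟦ x ⟧)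

    extend-cong : ∀ {φ ψ} → φ P.≈ ψ → extend φ P.≈ extend ψ
    extend-cong {φ} {ψ} φ≈ψ = fromValues
      (⊆*-map (λ { (x , φ⇓ , ψ⇓) → ⟦ x ⟧ , extend↓ {φ} φ⇓ , extend↓ {ψ} ψ⇓ }) (toValues φ≈ψ))

    extend-isHomomorphism : IsRingHomomorphism ∏K.rawRing ∏K.rawRing extend
    extend-isHomomorphism = record
      { isSemiringHomomorphism = record
        { isNearSemiringHomomorphism = record
          { +-isMonoidHomomorphism = record
            { isMagmaHomomorphism = record
              { isRelHomomorphism = record { cong = extend-cong }
              ; homo = λ φ ψ → lift₂ φ ψ {extend (φ P.+ ψ)} {extend φ P.+ extend ψ} λ {_} {x} {y} φ⇓ ψ⇓ →
                  extend↓ {φ P.+ ψ} (⇓+ φ⇓ ψ⇓) ,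
                  ⇓-cong (sym (τ.+-homo x y)) (⇓+ (extend↓ {φ} φ⇓) (extend↓ {ψ} ψ⇓))
              }
            ; ε-homo = begin
                extend P.0#        ≈⟨ extend-cong const.0#-homo ⟨
                extend (const 0#)  ≈⟨ extend-const 0# ⟩
                const ⟦ 0# ⟧       ≈⟨ const.⟦⟧-cong τ.0#-homo ⟩
                const 0#           ≈⟨ const.0#-homo ⟩
                P.0#               ∎
            }
          ; *-homo = λ φ ψ → lift₂ φ ψ {extend (φ P.* ψ)} {extend φ P.* extend ψ} λ {_} {x} {y} φ⇓ ψ⇓ →
              extend↓ {φ P.* ψ} (⇓* φ⇓ ψ⇓) ,
              ⇓-cong (sym (τ.*-homo x y)) (⇓* (extend↓ {φ} φ⇓) (extend↓ {ψ} ψ⇓))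
          }
        ; 1#-homo = begin
            extend P.1#        ≈⟨ extend-cong const.1#-homo ⟨
            extend (const 1#)  ≈⟨ extend-const 1# ⟩
            const ⟦ 1# ⟧       ≈⟨ const.⟦⟧-cong τ.1#-homo ⟩
            const 1#           ≈⟨ const.1#-homo ⟩
            P.1#               ∎
        }
      ; -‿homo = λ φ → lift₁ φ {extend (P.- φ)} {P.- extend φ} λ {_} {x} φ⇓ →
          extend↓ {P.- φ} (⇓neg φ⇓) , ⇓-cong (sym (τ.-‿homo x)) (⇓neg (extend↓ {φ} φ⇓))
      }
      where open SetoidReasoning ∏K.setoid

    extend-injective : ∀ {φ ψ} → extend φ P.≈ extend ψ → φ P.≈ ψ
    extend-injective {φ} {ψ} eq = fromValues (⊆*-map
      (λ { (((x , φ⇓) , (y , ψ⇓)) , (z , τφ⇓ , τψ⇓)) → x , φ⇓ , ⇓-cong (sym (τ.injective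
             (trans (⌜⌝-injective (⇓-deterministic (extend↓ {φ} φ⇓) τφ⇓))
                    (⌜⌝-injective (⇓-deterministic τψ⇓ (extend↓ {ψ} ψ⇓)))))) ψ⇓ })
      (⊆*-∩ (⊆*-∩ (converges φ) (converges ψ)) (toValues eq)))

    extend-fixes : ∀ φ → φ ∈ ∏ℚ 𝐊 𝒜 C → extend φ P.≈ φ
    extend-fixes φ (ψ , ψ∈ℚ , ψ≈φ) = ∏K.trans (extend-cong (∏K.sym ψ≈φ)) (∏K.trans extend-ψ ψ≈φ)
      where
      extend-ψ : extend ψ P.≈ ψ
      extend-ψ = lift₁ ψ {f = id} λ {_} {x} ψ⇓ →
        ⇓-cong (τ.fixes x (proj₁ (ψ∈ℚ ψ⇓) , ⌜⌝-injective (proj₂ (ψ∈ℚ ψ⇓)))) (extend↓ {ψ} ψ⇓) , ψ⇓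

  open Extension using (extend; extend-const; extend-cong; extend↓)

  extend-inverseʳ : ∀ τ φ → extend τ (extend (τ AutK.⁻¹) φ) P.≈ φ
  extend-inverseʳ τ φ = lift₁ φ {f = id} λ {_} {x} φ⇓ →
    ⇓-cong (AutK.inverseʳ τ x) (extend↓ τ {extend (τ AutK.⁻¹) φ} (extend↓ (τ AutK.⁻¹) {φ} φ⇓)) , φ⇓

  extension : AutK.Carrier → Aut∏.Carrier
  extension τ = record
    { ⟦_⟧               = extend τ
    ; isRingIsomorphism = record
      { isRingMonomorphism = record
        { isRingHomomorphism = extend-isHomomorphism
        ; injective          = extend-injective
        }
      ; surjective = λ φ → extend (τ AutK.⁻¹) φ , λ ψ≈ → ∏K.trans (extend-cong τ ψ≈) (extend-inverseʳ τ φ)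
      }
    ; fixes = extend-fixes
    }
    where open Extension τ hiding (extend; extend-cong)

  module ∏Σ = Sum ∏K.semiring

  sum↓ : ∀ {n} {φ : Fin n → Element} {x : Fin n → Carrier} {i} →
         (∀ k → φ k at i ↓ x k) → ∏Σ.sum φ at i ↓ Sum.sum semiring x
  sum↓ {zero}  φ⇓ = ⇓-subst (≡.sym to.0#-homo) (⇓numeral _)
  sum↓ {suc n} φ⇓ = ⇓+ (φ⇓ zero) (sum↓ (φ⇓ ∘ suc))

  coordinate : Fin degree → Element → Element
  coordinate k = P.pointwise₁ (coordinateᶜ k) (λ x → to (ι (proj₁ (coordinates ⌞ proj₂ x ⌟) k)))
    (λ x → subst (λ n → coordinateᶜ k [ n ∷ [] ]⇓ ⌜ ι (proj₁ (coordinates ⌞ proj₂ x ⌟) k) ⌝)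
             ⌜⌞ proj₂ x ⌟⌝ (proj₂ (proj₂ (coordinates ⌞ proj₂ x ⌟)) k))

  coordinate↓ : ∀ k {φ i x} → φ at i ↓ x → coordinate k φ at i ↓ ι (proj₁ (coordinates x) k)
  coordinate↓ k {x = x} φ⇓ = ⇓comp₁ φ⇓ (proj₂ (proj₂ (coordinates x)) k)

  coordinate-rational : ∀ k φ → coordinate k φ ∈ ∏ℚ 𝐊 𝒜 C
  coordinate-rational k φ = coordinate k φ , rational-values , P.≈-refl
    where
    rational-values : ∀ {i y} → code (coordinate k φ) [ i ∷ [] ]⇓ y → y ∈ ℚ⊆ 𝐊 𝒜
    rational-values ⇓y@(⇓comp (φ⇓ ∷ []) _) = _ , ⇓-deterministic
      (coordinate↓ k {φ} (⇓-subst (≡.sym ⌜⌞ values φ φ⇓ ⌟⌝) φ⇓)) ⇓y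

  expansion : ∀ φ → φ P.≈ ∏Σ.sum (λ k → coordinate k φ P.* const (basis k))
  expansion φ = lift₁ φ {f = id} λ {_} {x} φ⇓ → φ⇓ , ⇓-cong (sym (proj₁ (proj₂ (coordinates x))))
    (sum↓ {φ = λ k → coordinate k φ P.* const (basis k)} λ k → ⇓* (coordinate↓ k {φ} φ⇓) (const↓ (basis k)))

  determined-by-restriction : ∀ σ φ →
    Automorphism.⟦_⟧ σ φ P.≈ ∏Σ.sum (λ k → coordinate k φ P.* const (restrict σ (basis k)))
  determined-by-restriction σ φ = begin
    ⟦ φ ⟧                                                         ≈⟨ σ.⟦⟧-cong (expansion φ) ⟩
    ⟦ ∏Σ.sum (λ k → coordinate k φ P.* const (basis k)) ⟧
      ≈⟨ sum-homo {R = P.commutativeRing} {S = P.commutativeRing} σ.isRingHomomorphism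
           (λ k → coordinate k φ P.* const (basis k)) ⟩
    ∏Σ.sum (λ k → ⟦ coordinate k φ P.* const (basis k) ⟧)
      ≈⟨ ∏Σ.sum-cong-≋ {degree} (λ k → ∏K.trans (σ.*-homo (coordinate k φ) (const (basis k)))
           (∏K.*-cong (σ.fixes (coordinate k φ) (coordinate-rational k φ)) (∏K.sym (const-restrict σ (basis k))))) ⟩
    ∏Σ.sum (λ k → coordinate k φ P.* const (restrict σ (basis k)))  ∎
    where
    module σ = Automorphism σ
    open σ using (⟦_⟧)
    open SetoidReasoning ∏K.setoid

  restriction-isGroupIsomorphism : IsGroupIsomorphism Aut∏.rawGroup AutK.rawGroup restriction
  restriction-isGroupIsomorphism = record
    { isGroupMonomorphism = record
      { isGroupHomomorphism = record
        { isMonoidHomomorphism = record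
          { isMagmaHomomorphism = record
            { isRelHomomorphism = record { cong = λ {σ} {τ} σ≈τ x →
                restrict-unique σ (∏K.trans (σ≈τ (const x)) (∏K.sym (const-restrict τ x))) }
            ; homo = restrict-∘
            }
          ; ε-homo = λ x → restrict-unique Aut∏.ε P.≈-refl
          }
        ; ⁻¹-homo = λ σ → inverseʳ-unique (restriction σ) (restriction (σ Aut∏.⁻¹)) (restrict-inverseʳ σ)
        }
      ; injective = λ {σ} {τ} σ≈τ φ → ∏K.trans (determined-by-restriction σ φ) (∏K.trans
          (∏Σ.sum-cong-≋ {degree} (λ k → ∏K.*-congˡ {coordinate k φ} (const.⟦⟧-cong (σ≈τ (basis k)))))
          (∏K.sym (determined-by-restriction τ φ)))
      }
    ; surjective = λ τ → extension τ , λ {σ} σ≈ x →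
        restrict-unique σ (∏K.trans (σ≈ (const x)) (extend-const τ x))
    }
    where open GroupProperties AutK using (inverseʳ-unique)

theorem3p7 : ∀ {c ℓ p} (K : NumberField c ℓ)
    (𝒜 : ComputablePresentation (NumberField.commutativeRing K))
    (C : Pred ℕ p) → Cohesive C →
    Aut (∏ C (ComputablePresentation.structure 𝒜)) (∏ℚ K 𝒜 C)
    ≅ Aut (NumberField.commutativeRing K) (NumberField.rationals K)
theorem3p7 K 𝒜 C cohesive = restriction , restriction-isGroupIsomorphism
  where open CohesivePower K 𝒜 C cohesive
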